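{- Let $i\ge 3$ and $k\ge 3$ be integers. Then: (a) $g_3(L_i,L_{i+2},L_{i+k})=(4L_i-1)L_{i+2}-L_i$ whenever $k\ge i+5$; (b) $g_3(L_i,L_{i+2},L_{2i+4})=(4F_{i-1}-F_{i-2}-1)L_{i+2}+L_{2i+4}-L_i$; (c) $g_3(L_i,L_{i+2},L_{2i+3})=(4F_{i+1}-1)L_{i+2}-L_i$; (d) $g_3(L_i,L_{i+2},L_{2i+2})=(F_i+2F_{i-3}-1)L_{i+2}+2L_{2i+2}-L_i$; (e) $g_3(L_i,L_{i+2},L_{2i+1})=(F_{i-1}-1)L_{i+2}+3L_{2i+1}-L_i$; (f) $g_3(L_i,L_{i+2},L_{2i})=(2F_{i-3}-1)L_{i+2}+4L_{2i}-L_i$ for $i\ge 4$, and $g_3(L_3,L_5,L_6)=3L_5+2L_6-L_3=69$; (g) if $r=\lfloor (L_i-1)/F_k\rfloor\ge 3$ (equivalently $k\le i-1$), then $$g_3(L_i,L_{i+2},L_{i+k})=\begin{cases}(L_i-rF_k-1)L_{i+2}+(r+3)L_{i+k}-L_i & \text{if } (L_i-rF_k)L_{i+2}\ge F_{k-2}L_i,\\ (F_k-1)L_{i+2}+(r+2)L_{i+k}-L_i & \text{if } (L_i-rF_k)L_{i+2}< F_{k-2}L_i.\end{cases}$$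
   Context: Fibonacci numbers: $F_0=0$, $F_1=1$, $F_n=F_{n-1}+F_{n-2}$. Lucas numbers: $L_0=2$, $L_1=1$, $L_n=L_{n-1}+L_{n-2}$. For positive integers $a_1,\dots,a_l$ with $\gcd(a_1,\dots,a_l)=1$ and an integer $n$, let $d(n;a_1,\dots,a_l)$ be the number of tuples $(x_1,\dots,x_l)$ of nonnegative integers with $a_1x_1+\dots+a_lx_l=n$. For a nonnegative integer $p$, the $p$-Frobenius number $g_p(a_1,\dots,a_l)$ is the largest integer $n$ with $d(n;a_1,\dots,a_l)\le p$.
   Formalization: In (f), the displayed value 69 for g_3(L_3,L_5,L_6)=3L_5+2L_6-L_3 is an arithmetic slip: with L_3=4, L_5=11, L_6=18 the expression equals 65, and the formal theorem states the symbolic formula with the value 65. -}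

module Defs where

open import Data.Fin.Base using (Fin; zero; suc)
open import Data.Integer.Base as ℤ using (ℤ; +_; ∣_∣)
import Data.Integer.Properties as ℤₚ
open import Data.List.Base using (List; []; _∷_; length; lookup; filter; upTo; cartesianProductWith)
open import Data.List.Membership.Propositional using (_∈_)
open import Data.List.Membership.Propositional.Properties
  using (∈-lookup; ∈-filter⁺; ∈-filter⁻; ∈-upTo⁺; ∈-cartesianProductWith⁺)
open import Data.List.Membership.Propositional.Properties.WithK using (unique⇒irrelevant)
open import Data.List.Relation.Unary.Any using (here; index)
open import Data.List.Relation.Unary.Any.Properties using (lookup-index)
open import Data.List.Relation.Unary.Unique.Propositional using (Unique; []; _∷_)
open import Data.List.Relation.Unary.Unique.Propositional.Properties
  using (filter⁺; upTo⁺; cartesianProductWith⁺)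
import Data.List.Relation.Unary.All as ListAll
open import Data.Nat.Base
open import Data.Nat.Divisibility
  using (_∣_; ∣-trans; ∣m+n∣m⇒∣n; ∣1⇒≡1)
open import Data.Nat.GCD using (gcd; gcd[m,n]∣m; gcd[m,n]∣n)
open import Data.Nat.Properties hiding (≡-irrelevant)
open import Data.Product.Base using (Σ-syntax; _×_; _,_; proj₁; proj₂)
open import Data.Vec.Base as Vec using (Vec; []; _∷_)
open import Data.Vec.Properties using (∷-injective)
open import Data.Vec.Relation.Unary.All using (All; []; _∷_)
open import Function.Bundles using (_↔_; mk↔ₛ′)
open import Relation.Binary.PropositionalEquality
open import Relation.Binary.PropositionalEquality.WithK using (≡-irrelevant)

------------------------------------------------------------------------
-- Fibonacci and Lucas numbers

fib : ℕ → ℕ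
fib 0             = 0
fib 1             = 1
fib (suc (suc n)) = fib (suc n) + fib n

lucas : ℕ → ℕ
lucas 0             = 2
lucas 1             = 1
lucas (suc (suc n)) = lucas (suc n) + lucas n

-- Integer-valued versions, so that subtraction is not truncated.

F : ℕ → ℤ
F n = + fib n

L : ℕ → ℤ
L n = + lucas n

0<fib : ∀ n → 0 < fib (suc n)
0<fib zero    = z<s
0<fib (suc n) = ≤-trans (0<fib n) (m≤m+n (fib (suc n)) (fib n))

fib-nonZero : ∀ {m k} → m < k → NonZero (fib k)
fib-nonZero (s≤s {n = k} _) = >-nonZero (0<fib k)

0<lucas : ∀ n → 0 < lucas n
0<lucas zero          = z<s
0<lucas (suc zero)    = z<s
0<lucas (suc (suc n)) = ≤-trans (0<lucas (suc n)) (m≤m+n (lucas (suc n)) (lucas n))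

------------------------------------------------------------------------
-- Representations by a tuple of positive integers of gcd 1

record Generators (l : ℕ) : Set where
  constructor mkGenerators
  field
    values   : Vec ℕ l
    positive : All NonZero values
    coprime  : Vec.foldr′ gcd 0 values ≡ 1

open Generators

-- a₁ x₁ + ⋯ + aₗ xₗ
combination : ∀ {l} → Vec ℕ l → Vec ℕ l → ℕ
combination a x = Vec.sum (Vec.zipWith _*_ a x)

Representation : ∀ {l} → ℤ → Generators l → Set
Representation {l} n A = Σ[ x ∈ Vec ℕ l ] + combination (values A) x ≡ n

tuplesUpTo : ∀ l → ℕ → List (Vec ℕ l)
tuplesUpTo zero    N = [] ∷ []
tuplesUpTo (suc l) N = cartesianProductWith _∷_ (upTo (suc N)) (tuplesUpTo l N)

-- As the generators are positive, every entry of a representation of n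
-- is at most ∣ n ∣, so the search below is exhaustive (see d-counts).
representations : ∀ {l} → ℤ → Generators l → List (Vec ℕ l)
representations {l} n A =
  filter (λ x → + combination (values A) x ℤₚ.≟ n) (tuplesUpTo l ∣ n ∣)

d : ∀ {l} → ℤ → Generators l → ℕ
d n A = length (representations n A)

private
  tuplesUpTo-unique : ∀ l N → Unique (tuplesUpTo l N)
  tuplesUpTo-unique zero    N = ListAll.[] ∷ []
  tuplesUpTo-unique (suc l) N =
    cartesianProductWith⁺ _∷_ ∷-injective (upTo⁺ (suc N)) (tuplesUpTo-unique l N)

  ∈-tuplesUpTo : ∀ {l N} (a x : Vec ℕ l) → All NonZero a →
                 combination a x ≤ N → x ∈ tuplesUpTo l N
  ∈-tuplesUpTo []      []      []         _  = here refl
  ∈-tuplesUpTo (a ∷ as) (x ∷ xs) (a≢0 ∷ as≢0) le =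
    ∈-cartesianProductWith⁺ _∷_
      (∈-upTo⁺ (s≤s (≤-trans (m≤n*m x a {{a≢0}}) (≤-trans (m≤m+n _ _) le))))
      (∈-tuplesUpTo as xs as≢0 (≤-trans (m≤n+m _ (a * x)) le))

  index-∈-lookup : ∀ {A : Set} (xs : List A) i → index (∈-lookup {xs = xs} i) ≡ i
  index-∈-lookup (x ∷ xs) zero    = refl
  index-∈-lookup (x ∷ xs) (suc i) = cong suc (index-∈-lookup xs i)

  Σ-≡ : ∀ {A : Set} {f : A → ℤ} {n : ℤ} {u v : Σ[ x ∈ A ] f x ≡ n} →
        proj₁ u ≡ proj₁ v → u ≡ v
  Σ-≡ {u = x , p} {v = .x , q} refl = cong (x ,_) (≡-irrelevant p q)

d-counts : ∀ {l} n (A : Generators l) → Fin (d n A) ↔ Representation n A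
d-counts {l} n A = mk↔ₛ′ to from to∘from from∘to
  where
  P? = λ x → + combination (values A) x ℤₚ.≟ n
  xs = representations n A

  member : (r : Representation n A) → proj₁ r ∈ xs
  member (x , eq) = ∈-filter⁺ P?
    (∈-tuplesUpTo (values A) x (positive A) (≤-reflexive (cong ∣_∣ eq))) eq

  to : Fin (d n A) → Representation n A
  to i = lookup xs i , proj₂ (∈-filter⁻ P? {xs = tuplesUpTo l ∣ n ∣} (∈-lookup {xs = xs} i))

  from : Representation n A → Fin (d n A)
  from r = index (member r)

  to∘from : ∀ r → to (from r) ≡ r
  to∘from r = Σ-≡ (sym (lookup-index (member r)))

  from∘to : ∀ i → from (to i) ≡ i
  from∘to i = trans
    (cong index (unique⇒irrelevant (filter⁺ P? (tuplesUpTo-unique l ∣ n ∣))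
                  (member (to i)) (∈-lookup i)))
    (index-∈-lookup xs i)

-- g = g_p(A): g is the largest integer n with d(n; A) ≤ p.
IsFrobeniusNumber : ∀ {l} → ℕ → Generators l → ℤ → Set
IsFrobeniusNumber p A g = d g A ≤ p × (∀ n → d n A ≤ p → n ℤ.≤ g)

------------------------------------------------------------------------
-- The triple (Lᵢ, Lᵢ₊₂, Lₘ)

private
  lucas-consecutive : ∀ {c} n → c ∣ lucas n → c ∣ lucas (suc n) → c ∣ 1
  lucas-consecutive zero    _ q = q
  lucas-consecutive (suc n) p q = lucas-consecutive n (∣m+n∣m⇒∣n q p) p

  lucas-coprime : ∀ {c} n → c ∣ lucas n → c ∣ lucas (2 + n) → c ∣ 1
  lucas-coprime {c} n p q = lucas-consecutive n p
    (∣m+n∣m⇒∣n (subst (c ∣_) (+-comm (lucas (suc n)) (lucas n)) q) p)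

lucasTriple : ℕ → ℕ → Generators 3
lucasTriple i m = record
  { values   = lucas i ∷ lucas (i + 2) ∷ lucas m ∷ []
  ; positive = >-nonZero (0<lucas i) ∷ >-nonZero (0<lucas (i + 2)) ∷ >-nonZero (0<lucas m) ∷ []
  ; coprime  = ∣1⇒≡1 (lucas-coprime i
      (gcd[m,n]∣m (lucas i) g)
      (subst (λ j → gcd (lucas i) g ∣ lucas j) (+-comm i 2)
        (∣-trans (gcd[m,n]∣n (lucas i) g) (gcd[m,n]∣m (lucas (i + 2)) (gcd (lucas m) 0)))))
  }
  where g = gcd (lucas (i + 2)) (gcd (lucas m) 0)

{-# OPTIONS --safe #-}
module Submission where

-- Write a, b, c for the three generators. They satisfy c + e a = f b with
-- f = Fₖ, e = Fₖ₋₂, c = Lᵢ₊ₖ, so b y + c z = b (y + f z) − a e z, and its class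
-- modulo a is given by y + f z = j + q a with 0 ≤ j < a. Hence n has more than p
-- representations as soon as p + 1 pairs (q , z) in its class have a value
-- b y + c z < n + a. For the claimed g the bound g + a = b (Y − 1) + c Z is the
-- (p+1)-st smallest value of one class, and no class has a larger one; the
-- former holds because f (b y + c z) = c (y + f z) + a e y and e Y ≤ c, so that
-- passing to a larger q always costs more than any gain in y. For k = i, …, i + 4
-- all quantities are linear forms in two consecutive Fibonacci numbers and the
-- inequalities hold coefficient by coefficient; for k < i one divides a by f.

-- A pair (q , z) is available in class j exactly when y = j + q a - f z is nonnegative, that is,
-- from j = f z - q a on, and its value grows with j. Between two such thresholds one set of four
-- pairs serves every class, and only the right end of the interval has to be checked. The costliest
-- right end yields g; this is the origin of J, Q, Y and Z (J = f - a or J = 2 f - a, for instance,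
-- and J = a when the last interval is the worst). Comparing coefficients is sufficient but not
-- necessary, so the choice of the two Fibonacci numbers matters. Lowering their indices by one
-- turns the coefficients (x , y) into (x + y , x), which only weakens what has to be compared. The
-- lowest pair that is nonnegative for all i ≥ 3 is Fᵢ₋₃, Fᵢ₋₄, with F₋₁ = 1 at i = 3; the number
-- Fᵢ₋₄ itself occurs, as the threshold f - 3 a for k = i + 4. For k = i the formula fails at i = 3.
-- There i ≥ 4 permits indices lower by one more, and i = 3 is a separate computation.

open import Defs

-- Bounding the number of representations by labels.

module Counting where
  open import Data.Fin.Base using (Fin; zero; suc)
  open import Data.Fin.Properties using (injective⇒≤)
  open import Data.Integer.Base using (ℤ; +_)
  open import Data.List.Base using (List; []; _∷_; length; lookup)
  open import Data.List.Membership.Propositional using (_∈_)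
  open import Data.List.Membership.Propositional.Properties using (∈-lookup)
  open import Data.List.Membership.Setoid.Properties using (index-injective)
  open import Data.List.Relation.Unary.All as All using (All; []; _∷_)
  open import Data.List.Relation.Unary.Any using (index)
  open import Data.List.Relation.Unary.Unique.Propositional using (Unique; []; _∷_)
  open import Data.Nat.Base using (ℕ; _≤_)
  open import Data.Product.Base using (∃-syntax; _×_; _,_; proj₁; proj₂)
  open import Function.Bundles using (Inverse)
  open import Relation.Binary.PropositionalEquality
  open import Relation.Nullary.Negation using (contradiction)

  lookup-injective : ∀ {X : Set} {xs : List X} → Unique xs →
                     ∀ {i j} → lookup xs i ≡ lookup xs j → i ≡ j
  lookup-injective (_ ∷ _)  {zero}  {zero}  _  = refl
  lookup-injective (x∉ ∷ _) {zero}  {suc j} eq = contradiction eq (All.lookup x∉ (∈-lookup j))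
  lookup-injective (x∉ ∷ _) {suc i} {zero}  eq = contradiction (sym eq) (All.lookup x∉ (∈-lookup i))
  lookup-injective (_ ∷ u)  {suc i} {suc j} eq = cong suc (lookup-injective u eq)

  module _ {l} (n : ℤ) (A : Generators l) {X : Set} (R : Representation n A → X → Set) where

    private module d↔ = Inverse (d-counts n A)

    -- With a relation `R` in place of a labelling function, the two bounds can ask for separate
    -- properties: totality and injectivity here, functionality and realisability in `length≤d`.
    d≤length : (xs : List X) → (∀ {r r′ x} → R r x → R r′ x → r ≡ r′) →
               (∀ r → ∃[ x ] x ∈ xs × R r x) → d n A ≤ length xs
    d≤length xs injective label = injective⇒≤ {f = λ i → position (d↔.to i)}
      (λ {i} {j} eq → trans (sym (d↔.strictlyInverseʳ i))
        (trans (cong d↔.from (position-injective eq)) (d↔.strictlyInverseʳ j)))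
      where
      position : Representation n A → Fin (length xs)
      position r = index (proj₁ (proj₂ (label r)))

      position-injective : ∀ {r r′} → position r ≡ position r′ → r ≡ r′
      position-injective {r} {r′} eq with label r | label r′
      ... | x , x∈ , Rx | x′ , x′∈ , Rx′ =
        injective Rx (subst (R r′) (sym (index-injective (setoid X) x∈ x′∈ eq)) Rx′)

    length≤d : {xs : List X} → Unique xs → (∀ {r x x′} → R r x → R r x′ → x ≡ x′) →
               All (λ x → ∃[ r ] R r x) xs → length xs ≤ d n A
    length≤d {xs} unique functional realise = injective⇒≤ {f = λ i → d↔.from (proj₁ (point i))}
      (λ {i} {j} eq → lookup-injective unique (functional (proj₂ (point i))
        (subst (λ r → R r (lookup xs j)) (sym (from-injective eq)) (proj₂ (point j)))))
      where
      point : ∀ i → ∃[ r ] R r (lookup xs i)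
      point i = All.lookup realise (∈-lookup i)

      from-injective : ∀ {r r′} → d↔.from r ≡ d↔.from r′ → r ≡ r′
      from-injective {r} {r′} eq = trans (sym (d↔.strictlyInverseˡ r))
        (trans (cong d↔.to eq) (d↔.strictlyInverseˡ r′))

-- Congruences modulo a, without negative numbers.

module Residues where
  open import Data.Nat.Base
  open import Data.Nat.Properties
  open import Data.Nat.Coprimality using (Coprime; coprime-Bézout; coprime-divisor)
  open import Data.Nat.Divisibility using (_∣_; ∣m+n∣m⇒∣n; >⇒∤; m∣m*n)
  open import Data.Nat.DivMod using (_/_; _%_; m≡m%n+[m/n]*n; m%n<n)
  open import Data.Nat.GCD using (module Bézout)
  open import Data.Nat.Tactic.RingSolver using (solve)
  open import Data.List.Base using ([]; _∷_)
  open import Data.Product.Base using (∃-syntax; _×_; _,_)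
  open import Data.Sum.Base using (inj₁; inj₂)
  open import Relation.Binary.PropositionalEquality
  open import Relation.Nullary.Negation using (contradiction)

  ∣-<⇒≡0 : ∀ {a m} → a ∣ m → m < a → m ≡ 0
  ∣-<⇒≡0 {m = zero}  _   _   = refl
  ∣-<⇒≡0 {m = suc _} a∣m m<a = contradiction a∣m (>⇒∤ m<a)

  quotient-remainder : ∀ a .{{_ : NonZero a}} s → ∃[ j ] ∃[ q ] (j < a × s ≡ j + q * a)
  quotient-remainder a s = s % a , s / a , m%n<n s a , m≡m%n+[m/n]*n s a

  -- A congruence modulo `a` is written by adding a multiple of `a` on both sides, so both signs in
  -- Bézout's identity fit one statement.
  inverse : ∀ {a b} .{{_ : NonZero a}} → Coprime a b → ∃[ i ] ∃[ u ] ∃[ v ] b * i + a * u ≡ 1 + a * v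
  inverse {suc a} {b} cop with coprime-Bézout cop
  ... | Bézout.-+ x y eq = y , 0 , x , (begin
    b * y + suc a * 0   ≡⟨ solve (a ∷ b ∷ y ∷ []) ⟩
    y * b               ≡⟨ eq ⟨
    1 + x * suc a       ≡⟨ cong suc (*-comm x (suc a)) ⟩
    1 + suc a * x       ∎)
    where open ≡-Reasoning
  -- Here `b * y` is -1 modulo `suc a`; the factor `a`, which is -1 as well, corrects the sign.
  ... | Bézout.+- x y eq = a * y , x , b * y , (begin
    b * (a * y) + suc a * x      ≡⟨ cong (b * (a * y) +_) (*-comm (suc a) x) ⟩
    b * (a * y) + x * suc a      ≡⟨ cong (b * (a * y) +_) eq ⟨
    b * (a * y) + (1 + y * b)    ≡⟨ solve (a ∷ b ∷ y ∷ []) ⟩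
    1 + suc a * (b * y)          ∎)
    where open ≡-Reasoning

  residue : ∀ {a b} .{{_ : NonZero a}} → Coprime a b → ∀ m →
            ∃[ j ] (j < a × ∃[ u ] ∃[ v ] b * j + a * u ≡ m + a * v)
  residue {a} {b} cop m with inverse cop
  ... | i , u , v , eq with quotient-remainder a (i * m)
  ... | j , q , j<a , im≡ = j , j<a , b * q + u * m , v * m , (begin
    b * j + a * (b * q + u * m) ≡⟨ solve (a ∷ b ∷ j ∷ q ∷ u ∷ m ∷ []) ⟩
    b * (j + q * a) + a * u * m ≡⟨ cong (λ s → b * s + a * u * m) im≡ ⟨
    b * (i * m) + a * u * m     ≡⟨ solve (a ∷ b ∷ i ∷ u ∷ m ∷ []) ⟩
    (b * i + a * u) * m         ≡⟨ cong (_* m) eq ⟩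
    (1 + a * v) * m             ≡⟨ solve (a ∷ v ∷ m ∷ []) ⟩
    m + a * (v * m)             ∎)
    where open ≡-Reasoning

  private
    residue-unique-≤ : ∀ {a b} → Coprime a b → ∀ {i j u v} → j < a → i ≤ j →
                       b * i + a * u ≡ b * j + a * v → i ≡ j
    residue-unique-≤ {a} {b} cop {i} {j} {u} {v} j<a i≤j eq =
      ≤-antisym i≤j (m∸n≡0⇒m≤n (∣-<⇒≡0 a∣j∸i (≤-<-trans (m∸n≤m j i) j<a)))
      where
      open ≡-Reasoning
      shifted : a * v + b * (j ∸ i) ≡ a * u
      shifted = +-cancelˡ-≡ (b * i) _ _ (begin
        b * i + (a * v + b * (j ∸ i)) ≡⟨ assoc (j ∸ i) ⟩
        b * (i + (j ∸ i)) + a * v     ≡⟨ cong (λ k → b * k + a * v) (m+[n∸m]≡n i≤j) ⟩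
        b * j + a * v                 ≡⟨ eq ⟨
        b * i + a * u                 ∎)
        where
        assoc : ∀ k → b * i + (a * v + b * k) ≡ b * (i + k) + a * v
        assoc k = solve (a ∷ b ∷ i ∷ v ∷ k ∷ [])

      a∣j∸i : a ∣ j ∸ i
      a∣j∸i = coprime-divisor cop (∣m+n∣m⇒∣n (subst (a ∣_) (sym shifted) (m∣m*n u)) (m∣m*n v))

  residue-unique : ∀ {a b} → Coprime a b → ∀ {i j u v} → i < a → j < a →
                   b * i + a * u ≡ b * j + a * v → i ≡ j
  residue-unique cop {i} {j} {u} {v} i<a j<a eq with ≤-total i j
  ... | inj₁ i≤j = residue-unique-≤ cop {u = u} {v} j<a i≤j eq
  ... | inj₂ j≤i = sym (residue-unique-≤ cop {u = v} {u} i<a j≤i (sym eq))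

  -- The difference of `t` and `m` is a multiple of `a`, and `t` exceeds `m` by less than `a`, so
  -- `t ≤ m`. The witness becomes the entry at the generator `a` of a representation.
  congruent-below : ∀ {a t m u v} → t + a * u ≡ m + a * v → t < m + a → ∃[ x ] a * x + t ≡ m
  congruent-below {a} {t} {m} {u} {v} eq t<m+a with ≤-total u v
  ... | inj₂ v≤u = u ∸ v , +-cancelʳ-≡ (a * v) _ _ (begin
    a * (u ∸ v) + t + a * v ≡⟨ assoc (u ∸ v) ⟩
    t + a * (v + (u ∸ v))   ≡⟨ cong (λ w → t + a * w) (m+[n∸m]≡n v≤u) ⟩
    t + a * u               ≡⟨ eq ⟩
    m + a * v               ∎)
    where
    open ≡-Reasoning
    assoc : ∀ w → a * w + t + a * v ≡ t + a * (v + w)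
    assoc w = solve (a ∷ t ∷ v ∷ w ∷ [])
  ... | inj₁ u≤v = 0 , trans (cong (_+ t) (*-zeroʳ a)) (trans t≡ (trans (cong (m +_) (trans (cong (a *_) w≡0) (*-zeroʳ a))) (+-identityʳ m)))
    where
    w = v ∸ u
    t≡ : t ≡ m + a * w
    t≡ = +-cancelʳ-≡ (a * u) _ _ (trans eq (trans (cong (λ k → m + a * k) (sym (m∸n+n≡m u≤v))) (assoc w)))
      where
      assoc : ∀ w → m + a * (w + u) ≡ m + a * w + a * u
      assoc w = solve (a ∷ m ∷ w ∷ u ∷ [])
    w≡0 : w ≡ 0
    w≡0 = n<1⇒n≡0 (*-cancelˡ-< a w 1 (subst (a * w <_) (sym (*-identityʳ a)) (+-cancelˡ-< m _ _ (subst (_< m + a) t≡ t<m+a))))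

-- Values of pairs (q , z) inside one class.

module Values where
  open import Data.Nat.Base
  open import Data.Nat.Properties
  open import Data.Nat.Coprimality using (Coprime)
  open import Data.Nat.Tactic.RingSolver using (solve; solve-∀)
  open import Data.List.Base using ([]; _∷_)
  open import Data.Product.Base using (∃-syntax; _×_; _,_)
  open import Data.Sum.Base using (_⊎_; inj₁; inj₂)
  open import Relation.Binary.Definitions using (Tri; tri<; tri≈; tri>)
  open import Relation.Binary.PropositionalEquality hiding (J)
  open import Relation.Nullary.Negation using (contradiction)
  open Residues

  module _ (a b c e f : ℕ) (relation : c + e * a ≡ f * b) where

    value : ∀ y z → b * y + c * z + a * (e * z) ≡ b * (y + f * z)
    value y z = begin
      b * y + c * z + a * (e * z) ≡⟨ solve (a ∷ b ∷ c ∷ e ∷ y ∷ z ∷ []) ⟩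
      b * y + (c + e * a) * z     ≡⟨ cong (λ k → b * y + k * z) relation ⟩
      b * y + f * b * z           ≡⟨ solve (b ∷ f ∷ y ∷ z ∷ []) ⟩
      b * (y + f * z)             ∎
      where open ≡-Reasoning

    scaled-value : ∀ y z → f * (b * y + c * z) ≡ c * (y + f * z) + a * (e * y)
    scaled-value y z = begin
      f * (b * y + c * z)           ≡⟨ solve (b ∷ c ∷ f ∷ y ∷ z ∷ []) ⟩
      f * b * y + f * c * z         ≡⟨ cong (λ k → k * y + f * c * z) relation ⟨
      (c + e * a) * y + f * c * z   ≡⟨ solve (a ∷ c ∷ e ∷ f ∷ y ∷ z ∷ []) ⟩
      c * (y + f * z) + a * (e * y) ∎
      where open ≡-Reasoning

    value-congruent : ∀ {m j u v q y z} → b * j + a * u ≡ m + a * v → y + f * z ≡ j + q * a →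
                      b * y + c * z + a * (e * z + u) ≡ m + a * (v + b * q)
    value-congruent {m} {j} {u} {v} {q} {y} {z} eq s≡ = begin
      b * y + c * z + a * (e * z + u)       ≡⟨ solve (a ∷ b ∷ c ∷ e ∷ y ∷ z ∷ u ∷ []) ⟩
      b * y + c * z + a * (e * z) + a * u   ≡⟨ cong (_+ a * u) (value y z) ⟩
      b * (y + f * z) + a * u               ≡⟨ cong (λ k → b * k + a * u) s≡ ⟩
      b * (j + q * a) + a * u               ≡⟨ solve (a ∷ b ∷ j ∷ q ∷ u ∷ []) ⟩
      b * j + a * u + a * (b * q)           ≡⟨ cong (_+ a * (b * q)) eq ⟩
      m + a * v + a * (b * q)               ≡⟨ solve (a ∷ b ∷ m ∷ v ∷ q ∷ []) ⟩
      m + a * (v + b * q)                   ∎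
      where open ≡-Reasoning

    -- Rewriting both sides by `value` removes `c`. If `suc (y + f * z)` and `Y + f * Z` agree, they
    -- cancel and only `x`, `z` and `Z` remain to be compared.
    value-balance : ∀ {x y z Y Z} → b * suc y + c * z + a * suc x ≡ b * Y + c * Z →
                    b * suc (y + f * z) + a * (suc x + e * Z) ≡ b * (Y + f * Z) + a * (e * z)
    value-balance {x} {y} {z} {Y} {Z} eq = begin
      b * suc (y + f * z) + a * (suc x + e * Z)                  ≡⟨ solve (a ∷ b ∷ e ∷ f ∷ x ∷ y ∷ z ∷ Z ∷ []) ⟩
      b * (suc y + f * z) + (a * suc x + a * (e * Z))            ≡⟨ cong (_+ (a * suc x + a * (e * Z))) (value (suc y) z) ⟨
      b * suc y + c * z + a * (e * z) + (a * suc x + a * (e * Z)) ≡⟨ regroup (b * suc y + c * z) (a * (e * z)) (a * suc x) (a * (e * Z)) ⟩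
      b * suc y + c * z + a * suc x + a * (e * Z) + a * (e * z)  ≡⟨ cong (λ k → k + a * (e * Z) + a * (e * z)) eq ⟩
      b * Y + c * Z + a * (e * Z) + a * (e * z)                  ≡⟨ cong (_+ a * (e * z)) (value Y Z) ⟩
      b * (Y + f * Z) + a * (e * z)                              ∎
      where
      open ≡-Reasoning
      regroup : ∀ k l m n → k + l + (m + n) ≡ k + m + n + l
      regroup = solve-∀

    module _ .{{_ : NonZero a}} .{{_ : NonZero f}} (coprime : Coprime a b) {J Q Y Z : ℕ}
             (0<J : 0 < J) (J≤a : J ≤ a) (top : J + Q * a ≡ Y + f * Z) (steep : e * Y ≤ c) where

      private
        j+1≡J : suc (J ∸ 1) ≡ J
        j+1≡J = m+[n∸m]≡n 0<J

        scaled-top : f * (b * Y + c * Z) ≤ c * (J + suc Q * a)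
        scaled-top = begin
          f * (b * Y + c * Z)           ≡⟨ scaled-value Y Z ⟩
          c * (Y + f * Z) + a * (e * Y) ≤⟨ +-monoʳ-≤ (c * (Y + f * Z)) (*-monoʳ-≤ a steep) ⟩
          c * (Y + f * Z) + a * c       ≡⟨ cong (λ s → c * s + a * c) top ⟨
          c * (J + Q * a) + a * c       ≡⟨ solve (a ∷ c ∷ J ∷ Q ∷ []) ⟩
          c * (J + suc Q * a)           ∎
          where open ≤-Reasoning

        same-residue : ∀ {j q u v} → j < a → b * suc (j + q * a) + a * u ≡ b * (J + Q * a) + a * v → suc j ≡ J
        same-residue {j} {q} {u} {v} j<a eq = trans (cong suc
          (residue-unique coprime {u = b * q + u} {b * Q + v} j<a (≤-trans (≤-reflexive j+1≡J) J≤a)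
            (+-cancelʳ-≡ b _ _ (begin
              b * j + a * (b * q + u) + b             ≡⟨ regroup j q u ⟩
              b * suc (j + q * a) + a * u             ≡⟨ eq ⟩
              b * (J + Q * a) + a * v                 ≡⟨ cong (λ k → b * (k + Q * a) + a * v) j+1≡J ⟨
              b * suc (J ∸ 1 + Q * a) + a * v         ≡⟨ regroup (J ∸ 1) Q v ⟨
              b * (J ∸ 1) + a * (b * Q + v) + b       ∎)))) j+1≡J
          where
          open ≡-Reasoning
          regroup : ∀ j q w → b * j + a * (b * q + w) + b ≡ b * suc (j + q * a) + a * w
          regroup j q w = solve (a ∷ b ∷ j ∷ q ∷ w ∷ [])

      -- The hypothesis is a representation of g with a + b added on both sides. Congruence gives
      -- the residue J - 1, `scaled-top` excludes rows above `Q`, and within row `Q` the value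
      -- decreases in z.
      classify : ∀ {x y z} → b * suc y + c * z + a * suc x ≡ b * Y + c * Z →
                 ∃[ q ] (suc (y + f * z) ≡ J + q * a × (q < Q ⊎ (q ≡ Q × Z < z)))
      classify {x} {y} {z} eq with quotient-remainder a (y + f * z)
      ... | j , q , j<a , s≡j+qa = q , s≡ , position (<-cmp q Q)
        where
        balance : b * suc (y + f * z) + a * (suc x + e * Z) ≡ b * (J + Q * a) + a * (e * z)
        balance = trans (value-balance {x} {y} {z} {Y} eq) (cong (λ s → b * s + a * (e * z)) (sym top))

        s≡ : suc (y + f * z) ≡ J + q * a
        s≡ = trans (cong suc s≡j+qa) (cong (_+ q * a) (same-residue {j} {q} j<a
          (trans (cong (λ s → b * suc s + a * (suc x + e * Z)) (sym s≡j+qa)) balance)))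

        position : Tri (q < Q) (q ≡ Q) (q > Q) → q < Q ⊎ (q ≡ Q × Z < z)
        position (tri< q<Q _ _) = inj₁ q<Q
        -- In the same row the balance leaves `a * (suc x + e * Z) ≡ a * (e * z)`, hence
        -- `e * Z < e * z`.
        position (tri≈ _ q≡Q _) = inj₂ (q≡Q , *-cancelˡ-< e Z z (*-cancelˡ-< a _ _
          (≤-trans (*-monoʳ-< a (m<n+m (e * Z) z<s)) (≤-reflexive (+-cancelˡ-≡ (b * (J + Q * a)) _ _
            (trans (cong (λ s → b * s + a * (suc x + e * Z)) (trans (cong (λ k → J + k * a) (sym q≡Q)) (sym s≡))) balance))))))
        position (tri> _ _ Q<q) = contradiction (begin-strict
          f * (b * Y + c * Z)                     ≤⟨ scaled-top ⟩
          c * (J + suc Q * a)                     ≤⟨ *-monoʳ-≤ c (+-monoʳ-≤ J (*-monoˡ-≤ a Q<q)) ⟩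
          c * (J + q * a)                         ≡⟨ cong (c *_) s≡ ⟨
          c * (suc y + f * z)                     ≤⟨ m≤m+n _ _ ⟩
          c * (suc y + f * z) + a * (e * suc y)   ≡⟨ scaled-value (suc y) z ⟨
          f * (b * suc y + c * z)                 <⟨ *-monoʳ-< f (m<m+n _ (≤-trans (>-nonZero⁻¹ a) (m≤m*n a (suc x)))) ⟩
          f * (b * suc y + c * z + a * suc x)     ≡⟨ cong (f *_) eq ⟩
          f * (b * Y + c * Z)                     ∎) (<-irrefl refl)
          where open ≤-Reasoning

-- Certificates and their soundness.

module Frobenius where
  import Data.Integer.Properties as ℤₚ
  open import Algebra.Properties.AbelianGroup ℤₚ.+-0-abelianGroup using (∙-cancelʳ)
  open import Data.Nat.Base
  open import Data.Nat.Properties hiding (≡-irrelevant)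
  open import Data.Nat.GCD using (gcd)
  open import Data.Nat.Coprimality using (Coprime)
  open import Data.Nat.Tactic.RingSolver using (solve-∀)
  open import Data.Integer.Base as ℤ using (ℤ; +_; -[1+_])

  open import Data.List.Base using (List; []; _∷_; length)
  open import Data.List.Membership.Propositional using (_∈_)
  open import Data.List.Relation.Unary.All as ListAll using ()
  open import Data.List.Relation.Unary.Unique.Propositional using (Unique)
  open import Data.Product.Base using (∃-syntax; _×_; _,_; proj₁; proj₂)
  open import Data.Sum.Base using (_⊎_)
  open import Data.Vec.Base as Vec using ([]; _∷_)
  open import Data.Vec.Relation.Unary.All as VecAll using (All)
  open import Relation.Binary.PropositionalEquality hiding (J)
  open import Relation.Binary.PropositionalEquality.WithK using (≡-irrelevant)
  open Counting
  open Residues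
  open Values

  -- `T` is g + a + b, and `suc y` absorbs the summand b, so `bounded` means b y + c z ≤ g + a with
  -- no subtraction.
  record Point (a b c f T j : ℕ) (qz : ℕ × ℕ) : Set where
    constructor mkPoint
    field
      y         : ℕ
      congruent : y + f * proj₂ qz ≡ j + proj₁ qz * a
      bounded   : b * suc y + c * proj₂ qz ≤ T

  -- The number g being certified is b (Y − 1) + c Z − a. The class of g is j = J − 1,
  -- and its exceptions are the pairs (q , z) that do represent g.
  record Certificate (p a b c e f Y Z : ℕ) : Set where
    field
      relation   : c + e * a ≡ f * b
      J Q        : ℕ
      0<J        : 0 < J
      J≤a        : J ≤ a
      top        : J + Q * a ≡ Y + f * Z
      steep      : e * Y ≤ c
      large      : a + b ≤ b * Y + c * Z
      exceptions : List (ℕ × ℕ)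
      few        : length exceptions ≤ p
      exhaustive : ∀ {y z q} → suc (y + f * z) ≡ J + q * a →
                   q < Q ⊎ (q ≡ Q × Z < z) → (q , z) ∈ exceptions
      covering   : ∀ {j} → j < a → ∃[ qzs ] (Unique qzs × p < length qzs ×
                   ListAll.All (Point a b c f (b * Y + c * Z) j) qzs)

  representation-≡ : ∀ {l n} {A : Generators l} {r r′ : Representation n A} → proj₁ r ≡ proj₁ r′ → r ≡ r′
  representation-≡ {r = x , r} {.x , r′} refl = cong (x ,_) (≡-irrelevant r r′)

  private
    regroup : ∀ a b c x y z → b * suc y + c * z + a * suc x ≡ a * x + (b * y + c * z) + (a + b)
    regroup = solve-∀

    regroup′ : ∀ b c y z → b * y + c * z + b ≡ b * suc y + c * z
    regroup′ = solve-∀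

  module _ {p a b c e f Y Z : ℕ} (cert : Certificate p a b c e f Y Z)
           (positive : All NonZero (a ∷ b ∷ c ∷ []))
           (gcd≡1 : Vec.foldr′ gcd 0 (a ∷ b ∷ c ∷ []) ≡ 1)
           (coprime : Coprime a b) where

    open Certificate cert

    private
      instance
        a≢0 : NonZero a
        a≢0 = VecAll.head positive
        f≢0 : NonZero f
        f≢0 = ≢-nonZero λ { refl → ≢-nonZero⁻¹ c {{VecAll.head (VecAll.tail (VecAll.tail positive))}} (m+n≡0⇒m≡0 c relation) }

      A : Generators 3
      A = mkGenerators (a ∷ b ∷ c ∷ []) positive gcd≡1

      T G : ℕ
      T = b * Y + c * Z
      G = T ∸ (a + b)

      G≡ : G + (a + b) ≡ T
      G≡ = m∸n+n≡m large

      -- The entry x need not be recorded: (q , z) determines y within the class j, and then n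
      -- determines x.
      Encodes : ℕ → ∀ {n} → Representation n A → ℕ × ℕ → Set
      Encodes j (x ∷ y ∷ z ∷ [] , _) (q , z′) = z ≡ z′ × y + f * z ≡ j + q * a

      encodes-injective : ∀ {j n} {r r′ : Representation n A} {t} →
                          Encodes j r t → Encodes j r′ t → r ≡ r′
      encodes-injective {r = x ∷ y ∷ z ∷ [] , r} {x′ ∷ y′ ∷ z ∷ [] , r′} {q , z} (refl , eq) (refl , eq′) =
        representation-≡ {A = A} (cong₂ (λ x y → x ∷ y ∷ z ∷ []) x≡x′ y≡y′)
        where
        y≡y′ : y ≡ y′
        y≡y′ = +-cancelʳ-≡ (f * z) y y′ (trans eq (sym eq′))
        x≡x′ : x ≡ x′
        x≡x′ = *-cancelˡ-≡ x x′ a (+-cancelʳ-≡ (b * y + (c * z + 0)) _ _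
          (trans (ℤₚ.+-injective (trans r (sym r′))) (cong (λ y → a * x′ + (b * y + (c * z + 0))) (sym y≡y′))))

      encodes-functional : ∀ {j n} {r : Representation n A} {t t′} → Encodes j r t → Encodes j r t′ → t ≡ t′
      encodes-functional {j} {r = x ∷ y ∷ z ∷ [] , r} {q , z} {q′ , z} (refl , eq) (refl , eq′) =
        cong (_, z) (*-cancelʳ-≡ q q′ a (+-cancelˡ-≡ j _ _ (trans (sym eq) eq′)))

      total : ∀ x y z → a * x + (b * y + c * z) ≡ G → b * suc y + c * z + a * suc x ≡ T
      total x y z eq = trans (regroup a b c x y z) (trans (cong (_+ (a + b)) eq) G≡)

      -- The value of a point is congruent to `m` and at most G + a, which is below `m + a`; so
      -- `congruent-below` supplies the missing entry x.
      realise : ∀ {m j u v} → G < m → b * j + a * u ≡ m + a * v →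
                ∀ {t} → Point a b c f T j t → ∃[ r ] Encodes j {+ m} r t
      realise {m} {j} {u} {v} G<m eq {q , z} (mkPoint y s≡ below) =
        let x , x≡ = congruent-below {a} {b * y + c * z} {m} {e * z + u} {v + b * q}
                       (value-congruent a b c e f relation {m} {j} {u} {v} {q} {y} {z} eq s≡) bound
        in (x ∷ y ∷ z ∷ [] , cong +_ (trans (cong (λ k → a * x + (b * y + k)) (+-identityʳ (c * z))) x≡))
         , refl , s≡
        where
        bound : b * y + c * z < m + a
        bound = ≤-<-trans (+-cancelʳ-≤ b _ _ (begin
          b * y + c * z + b     ≡⟨ regroup′ b c y z ⟩
          b * suc y + c * z     ≤⟨ below ⟩
          T                     ≡⟨ G≡ ⟨
          G + (a + b)           ≡⟨ +-assoc G a b ⟨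
          G + a + b             ∎)) (+-monoˡ-< a G<m)
          where open ≤-Reasoning

      many : ∀ {m} → G < m → p < d (+ m) A
      many {m} G<m =
        let j , j<a , u , v , eq = residue coprime m
            qzs , unique , enough , points = covering j<a
        in ≤-trans enough (length≤d (+ m) A (Encodes j) unique (λ {r} → encodes-functional {r = r})
             (ListAll.map (realise {u = u} {v} G<m eq) points))

      few-at-G : d (+ G) A ≤ p
      few-at-G = ≤-trans (d≤length (+ G) A (Encodes (J ∸ 1)) exceptions (λ {r} {r′} → encodes-injective {r = r} {r′}) label) few
        where
        label : (r : Representation (+ G) A) → ∃[ t ] (t ∈ exceptions × Encodes (J ∸ 1) r t)
        label (x ∷ y ∷ z ∷ [] , r) =
          let q , s≡ , position = classify a b c e f relation coprime 0<J J≤a top steep {x} {y} {z}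
                (total x y z (trans (cong (λ k → a * x + (b * y + k)) (sym (+-identityʳ (c * z)))) (ℤₚ.+-injective r)))
          in (q , z) , exhaustive s≡ position , refl , suc-injective (trans s≡ (cong (_+ q * a) (sym (m+[n∸m]≡n 0<J))))

      G-maximal : ∀ n → d n A ≤ p → n ℤ.≤ + G
      G-maximal (+ m)    d≤p = ℤ.+≤+ (≮⇒≥ λ G<m → <⇒≱ (many G<m) d≤p)
      -- Negative numbers lie below `G`, which is a genuine natural number because of `large`.
      G-maximal -[1+ _ ] _   = ℤ.-≤+

    frobenius : ∀ {g} → g ℤ.+ (+ a ℤ.+ + b) ≡ + (b * Y + c * Z) → IsFrobeniusNumber p A g
    frobenius {g} eq = subst (IsFrobeniusNumber p A)
      (sym (∙-cancelʳ (+ a ℤ.+ + b) g (+ G) (trans eq (cong +_ (sym G≡)))))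
      (few-at-G , G-maximal)

-- Criteria for bounding columns and producing points.

module Covering where
  open import Data.Nat.Base
  open import Data.Nat.Properties
  open import Data.Product.Base using (_,_)
  open import Relation.Binary.PropositionalEquality
  open Frobenius
  open Values

  -- Since y is nonnegative, f z stays strictly below s. This is how the pairs that could represent
  -- g are enumerated.
  column : ∀ {f k y z s} → suc (y + f * z) ≡ s → s ≤ f * k → z < k
  column {f} {k} {y} {z} eq s≤fk =
    *-cancelˡ-< f z k (≤-trans (s≤s (m≤n+m (f * z) y)) (≤-trans (≤-reflexive eq) s≤fk))

  -- `S` bounds the position for a whole range of classes at once. `cost` is the bound at `S`,
  -- rewritten by `value` so that `c` no longer occurs.
  point : ∀ a b c e f Y Z {j q z S} → c + e * a ≡ f * b → f * z ≤ j + q * a → j + q * a < S →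
          b * S + a * (e * Z) ≤ b * (Y + f * Z) + a * (e * z) → Point a b c f (b * Y + c * Z) j (q , z)
  point a b c e f Y Z {j} {q} {z} {S} relation fz≤s s<S cost =
    mkPoint y y+fz≡s (+-cancelʳ-≤ (a * (e * z) + a * (e * Z)) _ _ (begin
      b * suc y + c * z + (a * (e * z) + a * (e * Z)) ≡⟨ +-assoc (b * suc y + c * z) _ _ ⟨
      b * suc y + c * z + a * (e * z) + a * (e * Z)   ≡⟨ cong (_+ a * (e * Z)) (value a b c e f relation (suc y) z) ⟩
      b * suc (y + f * z) + a * (e * Z)               ≤⟨ +-monoˡ-≤ _ (*-monoʳ-≤ b (subst (_< S) (sym y+fz≡s) s<S)) ⟩
      b * S + a * (e * Z)                             ≤⟨ cost ⟩
      b * (Y + f * Z) + a * (e * z)                   ≡⟨ cong (_+ a * (e * z)) (value a b c e f relation Y Z) ⟨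
      b * Y + c * Z + a * (e * Z) + a * (e * z)       ≡⟨ +-assoc (b * Y + c * Z) _ _ ⟩
      b * Y + c * Z + (a * (e * Z) + a * (e * z))     ≡⟨ cong (b * Y + c * Z +_) (+-comm (a * (e * Z)) _) ⟩
      b * Y + c * Z + (a * (e * z) + a * (e * Z))     ∎))
    where
    open ≤-Reasoning
    y = j + q * a ∸ f * z
    y+fz≡s : y + f * z ≡ j + q * a
    y+fz≡s = m∸n+n≡m fz≤s

-- Linear and quadratic forms with natural coefficients.

module LinearForms where
  open import Data.Bool.Base using (T; _∧_)
  open import Data.Bool.Properties using (T-∧)
  open import Data.Nat.Base
  open import Data.Nat.Properties
  open import Data.Nat.Tactic.RingSolver using (solve-∀)
  open import Data.Product.Base using (_×_; _,_)
  open import Function.Bundles using (Equivalence)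
  open import Relation.Binary.PropositionalEquality

  -- (x , y) stands for x s + y t, and (x , y , z) for x s² + y s t + z t².
  Form Quadratic : Set
  Form      = ℕ × ℕ
  Quadratic = ℕ × ℕ × ℕ

  infixl 6 _⊕_ _⊞_
  infixl 7 _⊙_ _⊡_ _⊗_
  infix 4 _⊑_ _⊴_

  _⊕_ : Form → Form → Form
  (x , y) ⊕ (x′ , y′) = x + x′ , y + y′

  _⊙_ : ℕ → Form → Form
  n ⊙ (x , y) = n * x , n * y

  _⊗_ : Form → Form → Quadratic
  (x , y) ⊗ (x′ , y′) = x * x′ , x * y′ + y * x′ , y * y′

  _⊞_ : Quadratic → Quadratic → Quadratic
  (x , y , z) ⊞ (x′ , y′ , z′) = x + x′ , y + y′ , z + z′

  _⊡_ : ℕ → Quadratic → Quadratic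
  n ⊡ (x , y , z) = n * x , n * y , n * z

  -- Boolean, so that comparisons of numeral coefficients are solved by unification.
  _⊑_ : Form → Form → Set
  (x , y) ⊑ (x′ , y′) = T ((x ≤ᵇ x′) ∧ (y ≤ᵇ y′))

  _⊴_ : Quadratic → Quadratic → Set
  (x , y , z) ⊴ (x′ , y′ , z′) = T ((x ≤ᵇ x′) ∧ ((y ≤ᵇ y′) ∧ (z ≤ᵇ z′)))

  private
    ⊕-eq : ∀ s t x y x′ y′ → (x + x′) * s + (y + y′) * t ≡ x * s + y * t + (x′ * s + y′ * t)
    ⊕-eq = solve-∀

    ⊙-eq : ∀ s t n x y → n * x * s + n * y * t ≡ n * (x * s + y * t)
    ⊙-eq = solve-∀

    ⊗-eq : ∀ s t x y x′ y′ → x * x′ * (s * s) + (x * y′ + y * x′) * (s * t) + y * y′ * (t * t) ≡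
                             (x * s + y * t) * (x′ * s + y′ * t)
    ⊗-eq = solve-∀

    ⊞-eq : ∀ s t x y z x′ y′ z′ → (x + x′) * (s * s) + (y + y′) * (s * t) + (z + z′) * (t * t) ≡
           x * (s * s) + y * (s * t) + z * (t * t) + (x′ * (s * s) + y′ * (s * t) + z′ * (t * t))
    ⊞-eq = solve-∀

    ⊡-eq : ∀ s t n x y z → n * x * (s * s) + n * y * (s * t) + n * z * (t * t) ≡
                           n * (x * (s * s) + y * (s * t) + z * (t * t))
    ⊡-eq = solve-∀

  module Evaluation (s t : ℕ) where

    -- Opaque, lest numeral coefficients be unfolded into sums.
    opaque
      ⟦_⟧ : Form → ℕ
      ⟦ x , y ⟧ = x * s + y * t

      ⟦_⟧₂ : Quadratic → ℕ
      ⟦ x , y , z ⟧₂ = x * (s * s) + y * (s * t) + z * (t * t)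

      ⟦⊕⟧ : ∀ u v → ⟦ u ⊕ v ⟧ ≡ ⟦ u ⟧ + ⟦ v ⟧
      ⟦⊕⟧ (x , y) (x′ , y′) = ⊕-eq s t x y x′ y′

      ⟦⊙⟧ : ∀ n u → ⟦ n ⊙ u ⟧ ≡ n * ⟦ u ⟧
      ⟦⊙⟧ n (x , y) = ⊙-eq s t n x y

      ⟦⊗⟧ : ∀ u v → ⟦ u ⊗ v ⟧₂ ≡ ⟦ u ⟧ * ⟦ v ⟧
      ⟦⊗⟧ (x , y) (x′ , y′) = ⊗-eq s t x y x′ y′

      ⟦⊞⟧ : ∀ u v → ⟦ u ⊞ v ⟧₂ ≡ ⟦ u ⟧₂ + ⟦ v ⟧₂
      ⟦⊞⟧ (x , y , z) (x′ , y′ , z′) = ⊞-eq s t x y z x′ y′ z′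

      ⟦⊡⟧ : ∀ n u → ⟦ n ⊡ u ⟧₂ ≡ n * ⟦ u ⟧₂
      ⟦⊡⟧ n (x , y , z) = ⊡-eq s t n x y z

      ⟦⟧-mono : ∀ u v → u ⊑ v → ⟦ u ⟧ ≤ ⟦ v ⟧
      ⟦⟧-mono (x , y) (x′ , y′) u⊑v with Equivalence.to T-∧ u⊑v
      ... | x≤ , y≤ = +-mono-≤ (*-monoˡ-≤ s (≤ᵇ⇒≤ x x′ x≤)) (*-monoˡ-≤ t (≤ᵇ⇒≤ y y′ y≤))

      ⟦⟧₂-mono : ∀ u v → u ⊴ v → ⟦ u ⟧₂ ≤ ⟦ v ⟧₂
      ⟦⟧₂-mono (x , y , z) (x′ , y′ , z′) u⊴v with Equivalence.to T-∧ u⊴v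
      ... | x≤ , yz≤ with Equivalence.to T-∧ yz≤
      ... | y≤ , z≤ = +-mono-≤ (+-mono-≤ (*-monoˡ-≤ (s * s) (≤ᵇ⇒≤ x x′ x≤)) (*-monoˡ-≤ (s * t) (≤ᵇ⇒≤ y y′ y≤)))
                               (*-monoˡ-≤ (t * t) (≤ᵇ⇒≤ z z′ z≤))

      ⟦⟧-def : ∀ x y → ⟦ x , y ⟧ ≡ x * s + y * t
      ⟦⟧-def x y = refl

    ⟦n,n⟧ : ∀ n → ⟦ n , n ⟧ ≡ n * (s + t)
    ⟦n,n⟧ n = trans (⟦⟧-def n n) (sym (*-distribˡ-+ n s t))

    0-minimal : ∀ {n} → ⟦ 0 , 0 ⟧ ≤ n
    0-minimal = subst (_≤ _) (sym (⟦n,n⟧ 0)) z≤n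

-- Certificates for k = i, ..., i + 4 by comparison of coefficients.

module FormCertificates where
  open import Data.Nat.Base
  open import Data.Nat.Properties
  open import Data.List.Base using (List; []; _∷_; length)
  open import Data.List.Membership.Propositional using (_∈_)
  open import Data.List.Relation.Unary.All using (All; []; _∷_)
  open import Data.List.Relation.Unary.Any using (here; there)
  open import Data.List.Relation.Unary.Unique.Propositional using (Unique)
  open import Data.Product.Base using (∃-syntax; _×_; _,_)
  open import Data.Product.Properties using (≡-dec)
  open import Data.List.Relation.Unary.Unique.DecPropositional (≡-dec _≟_ _≟_) using (unique?)
  open import Data.Sum.Base using (inj₁; inj₂)
  open import Relation.Binary.PropositionalEquality hiding (J)
  open import Relation.Nullary.Decidable using (yes; no; True; toWitness)
  open import Relation.Nullary.Negation using (contradiction)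
  open Covering
  open Frobenius
  open LinearForms

  module _ (s t : ℕ) where
    open Evaluation s t

    module Forms (a b e f Y : Form) (Z : ℕ) {c : ℕ} (relation : c + ⟦ e ⟧ * ⟦ a ⟧ ≡ ⟦ f ⟧ * ⟦ b ⟧) where

      Below : ℕ → ℕ × ℕ → Set
      Below = Point ⟦ a ⟧ ⟦ b ⟧ c ⟦ f ⟧ (⟦ b ⟧ * ⟦ Y ⟧ + c * Z)

      Covered : ℕ → Set
      Covered j = ∃[ qzs ] (Unique qzs × 3 < length qzs × All (Below j) qzs)

      Column : Form → ℕ → ℕ → Set
      Column J q z = ∃[ y ] suc (y + ⟦ f ⟧ * z) ≡ ⟦ J ⟧ + q * ⟦ a ⟧

      private
        ⟦⊕⊙⟧ : ∀ u n v → ⟦ u ⊕ n ⊙ v ⟧ ≡ ⟦ u ⟧ + n * ⟦ v ⟧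
        ⟦⊕⊙⟧ u n v = trans (⟦⊕⟧ u (n ⊙ v)) (cong (⟦ u ⟧ +_) (⟦⊙⟧ n v))

        ⟦f⟧* : ∀ z → ⟦ z ⊙ f ⟧ ≡ ⟦ f ⟧ * z
        ⟦f⟧* z = trans (⟦⊙⟧ z f) (*-comm z ⟦ f ⟧)

        ⟦Y+fZ⟧ : ⟦ Y ⊕ Z ⊙ f ⟧ ≡ ⟦ Y ⟧ + ⟦ f ⟧ * Z
        ⟦Y+fZ⟧ = trans (⟦⊕⟧ Y (Z ⊙ f)) (cong (⟦ Y ⟧ +_) (⟦f⟧* Z))

        ⟦⊗⊞⊡⟧ : ∀ u v n → ⟦ u ⊗ v ⊞ n ⊡ (e ⊗ a) ⟧₂ ≡ ⟦ u ⟧ * ⟦ v ⟧ + ⟦ a ⟧ * (⟦ e ⟧ * n)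
        ⟦⊗⊞⊡⟧ u v n = begin
          ⟦ u ⊗ v ⊞ n ⊡ (e ⊗ a) ⟧₂                ≡⟨ ⟦⊞⟧ (u ⊗ v) (n ⊡ (e ⊗ a)) ⟩
          ⟦ u ⊗ v ⟧₂ + ⟦ n ⊡ (e ⊗ a) ⟧₂           ≡⟨ cong₂ _+_ (⟦⊗⟧ u v) (⟦⊡⟧ n (e ⊗ a)) ⟩
          ⟦ u ⟧ * ⟦ v ⟧ + n * ⟦ e ⊗ a ⟧₂          ≡⟨ cong (λ k → ⟦ u ⟧ * ⟦ v ⟧ + n * k) (⟦⊗⟧ e a) ⟩
          ⟦ u ⟧ * ⟦ v ⟧ + n * (⟦ e ⟧ * ⟦ a ⟧)     ≡⟨ cong (⟦ u ⟧ * ⟦ v ⟧ +_) (*-assoc n ⟦ e ⟧ ⟦ a ⟧) ⟨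
          ⟦ u ⟧ * ⟦ v ⟧ + n * ⟦ e ⟧ * ⟦ a ⟧       ≡⟨ cong (⟦ u ⟧ * ⟦ v ⟧ +_) (*-comm (n * ⟦ e ⟧) ⟦ a ⟧) ⟩
          ⟦ u ⟧ * ⟦ v ⟧ + ⟦ a ⟧ * (n * ⟦ e ⟧)     ≡⟨ cong (λ k → ⟦ u ⟧ * ⟦ v ⟧ + ⟦ a ⟧ * k) (*-comm n ⟦ e ⟧) ⟩
          ⟦ u ⟧ * ⟦ v ⟧ + ⟦ a ⟧ * (⟦ e ⟧ * n)     ∎
          where open ≡-Reasoning

        -- `c` is known only as f b - e a; a lower bound for it is tested with `e ⊗ a` moved to the
        -- other side.
        bounded-by-c : ∀ v → v ⊞ e ⊗ a ⊴ f ⊗ b → ⟦ v ⟧₂ ≤ c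
        bounded-by-c v le = +-cancelʳ-≤ (⟦ e ⟧ * ⟦ a ⟧) _ _ (begin
          ⟦ v ⟧₂ + ⟦ e ⟧ * ⟦ a ⟧    ≡⟨ cong (⟦ v ⟧₂ +_) (⟦⊗⟧ e a) ⟨
          ⟦ v ⟧₂ + ⟦ e ⊗ a ⟧₂       ≡⟨ ⟦⊞⟧ v (e ⊗ a) ⟨
          ⟦ v ⊞ e ⊗ a ⟧₂            ≤⟨ ⟦⟧₂-mono (v ⊞ e ⊗ a) (f ⊗ b) le ⟩
          ⟦ f ⊗ b ⟧₂                ≡⟨ ⟦⊗⟧ f b ⟩
          ⟦ f ⟧ * ⟦ b ⟧             ≡⟨ relation ⟨
          c + ⟦ e ⟧ * ⟦ a ⟧         ∎)
          where open ≤-Reasoning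

      -- Over the interval, y ≥ 0 is hardest to meet at `lo` and the cost is highest at `hi`; one
      -- comparison of forms at each end is enough.
      on-interval : ∀ lo hi {j} → ⟦ lo ⟧ ≤ j → j < ⟦ hi ⟧ → ∀ q z {_ : z ⊙ f ⊑ lo ⊕ q ⊙ a}
                    {_ : b ⊗ (hi ⊕ q ⊙ a) ⊞ Z ⊡ (e ⊗ a) ⊴ b ⊗ (Y ⊕ Z ⊙ f) ⊞ z ⊡ (e ⊗ a)} → Below j (q , z)
      on-interval lo hi {j} lo≤j j<hi q z {fz⊑} {cost} = point ⟦ a ⟧ ⟦ b ⟧ c ⟦ e ⟧ ⟦ f ⟧ ⟦ Y ⟧ Z {j} {q} relation
        (begin
          ⟦ f ⟧ * z             ≡⟨ ⟦f⟧* z ⟨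
          ⟦ z ⊙ f ⟧             ≤⟨ ⟦⟧-mono (z ⊙ f) (lo ⊕ q ⊙ a) fz⊑ ⟩
          ⟦ lo ⊕ q ⊙ a ⟧        ≡⟨ ⟦⊕⊙⟧ lo q a ⟩
          ⟦ lo ⟧ + q * ⟦ a ⟧    ≤⟨ +-monoˡ-≤ (q * ⟦ a ⟧) lo≤j ⟩
          j + q * ⟦ a ⟧         ∎)
        (begin-strict
          j + q * ⟦ a ⟧         <⟨ +-monoˡ-< (q * ⟦ a ⟧) j<hi ⟩
          ⟦ hi ⟧ + q * ⟦ a ⟧    ≡⟨ ⟦⊕⊙⟧ hi q a ⟨
          ⟦ hi ⊕ q ⊙ a ⟧        ∎)
        (begin
          ⟦ b ⟧ * ⟦ hi ⊕ q ⊙ a ⟧ + ⟦ a ⟧ * (⟦ e ⟧ * Z)      ≡⟨ ⟦⊗⊞⊡⟧ b (hi ⊕ q ⊙ a) Z ⟨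
          ⟦ b ⊗ (hi ⊕ q ⊙ a) ⊞ Z ⊡ (e ⊗ a) ⟧₂
            ≤⟨ ⟦⟧₂-mono (b ⊗ (hi ⊕ q ⊙ a) ⊞ Z ⊡ (e ⊗ a)) (b ⊗ (Y ⊕ Z ⊙ f) ⊞ z ⊡ (e ⊗ a)) cost ⟩
          ⟦ b ⊗ (Y ⊕ Z ⊙ f) ⊞ z ⊡ (e ⊗ a) ⟧₂                ≡⟨ ⟦⊗⊞⊡⟧ b (Y ⊕ Z ⊙ f) z ⟩
          ⟦ b ⟧ * ⟦ Y ⊕ Z ⊙ f ⟧ + ⟦ a ⟧ * (⟦ e ⟧ * z)       ≡⟨ cong (λ k → ⟦ b ⟧ * k + ⟦ a ⟧ * (⟦ e ⟧ * z)) ⟦Y+fZ⟧ ⟩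
          ⟦ b ⟧ * (⟦ Y ⟧ + ⟦ f ⟧ * Z) + ⟦ a ⟧ * (⟦ e ⟧ * z) ∎)
        where open ≤-Reasoning

      column< : ∀ {J z} q k {_ : J ⊕ q ⊙ a ⊑ k ⊙ f} → Column J q z → z < k
      column< {J} {z} q k {le} (y , eq) = column {⟦ f ⟧} {k} {y} {z} eq (begin
        ⟦ J ⟧ + q * ⟦ a ⟧   ≡⟨ ⟦⊕⊙⟧ J q a ⟨
        ⟦ J ⊕ q ⊙ a ⟧       ≤⟨ ⟦⟧-mono (J ⊕ q ⊙ a) (k ⊙ f) le ⟩
        ⟦ k ⊙ f ⟧           ≡⟨ ⟦f⟧* k ⟩
        ⟦ f ⟧ * k           ∎)
        where open ≤-Reasoning

      covered : ∀ {j qzs} → All (Below j) qzs → {_ : True (unique? qzs)} {_ : True (3 <? length qzs)} →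
                Covered j
      covered {qzs = qzs} points {unique} {enough} = qzs , toWitness unique , toWitness enough , points

      -- `(1 , 1)` is used for positivity because `s` or `t` alone may vanish. The condition on
      -- `2 ∸ Z` says Y + Z ≥ 2; together with a ≤ b ≤ c this gives b Y + c Z ≥ 2 b ≥ a + b.
      certificate : 0 < s + t → ∀ J Q → J ⊕ Q ⊙ a ≡ Y ⊕ Z ⊙ f →
                    (exceptions : List (ℕ × ℕ)) {_ : True (length exceptions ≤? 3)} →
                    (∀ {q z} → q < Q → Column J q z → (q , z) ∈ exceptions) →
                    (∀ {z} → Z < z → Column J Q z → (Q , z) ∈ exceptions) →
                    (∀ {j} → j < ⟦ a ⟧ → Covered j) →
                    {_ : (1 , 1) ⊑ J} {_ : J ⊑ a} {_ : a ⊑ b} {_ : (2 ∸ Z , 2 ∸ Z) ⊑ Y}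
                    {_ : b ⊗ (1 , 1) ⊞ e ⊗ a ⊴ f ⊗ b} {_ : e ⊗ Y ⊞ e ⊗ a ⊴ f ⊗ b} →
                    Certificate 3 ⟦ a ⟧ ⟦ b ⟧ c ⟦ e ⟧ ⟦ f ⟧ ⟦ Y ⟧ Z
      certificate 0<s+t J Q top exceptions {few} inner outer covering {1⊑J} {J⊑a} {a⊑b} {2⊑Y} {b⊴c} {eY⊴c} = record
        { relation   = relation
        ; J          = ⟦ J ⟧
        ; Q          = Q
        ; 0<J        = ≤-trans 0<⟦1,1⟧ (⟦⟧-mono (1 , 1) J 1⊑J)
        ; J≤a        = ⟦⟧-mono J a J⊑a
        ; top        = trans (sym (⟦⊕⊙⟧ J Q a)) (trans (cong ⟦_⟧ top) ⟦Y+fZ⟧)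
        ; steep      = ≤-trans (≤-reflexive (sym (⟦⊗⟧ e Y))) (bounded-by-c (e ⊗ Y) eY⊴c)
        ; large      = large
        ; exceptions = exceptions
        ; few        = toWitness few
        ; exhaustive = λ { {y} eq (inj₁ q<Q) → inner q<Q (y , eq)
                         ; {y} eq (inj₂ (refl , Z<z)) → outer Z<z (y , eq) }
        ; covering   = covering
        }
        where
        open ≤-Reasoning
        0<⟦1,1⟧ : 0 < ⟦ 1 , 1 ⟧
        0<⟦1,1⟧ = subst (0 <_) (sym (trans (⟦n,n⟧ 1) (*-identityˡ (s + t)))) 0<s+t

        b≤c : ⟦ b ⟧ ≤ c
        b≤c = begin
          ⟦ b ⟧                 ≤⟨ m≤m*n ⟦ b ⟧ ⟦ 1 , 1 ⟧ {{>-nonZero 0<⟦1,1⟧}} ⟩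
          ⟦ b ⟧ * ⟦ 1 , 1 ⟧     ≡⟨ ⟦⊗⟧ b (1 , 1) ⟨
          ⟦ b ⊗ (1 , 1) ⟧₂      ≤⟨ bounded-by-c (b ⊗ (1 , 1)) b⊴c ⟩
          c                     ∎

        2≤Y+Z : 2 ≤ ⟦ Y ⟧ + Z
        2≤Y+Z = begin
          2                     ≤⟨ m≤n+m∸n 2 Z ⟩
          Z + (2 ∸ Z)           ≡⟨ +-comm Z (2 ∸ Z) ⟩
          2 ∸ Z + Z             ≤⟨ +-monoˡ-≤ Z (m≤m*n (2 ∸ Z) (s + t) {{>-nonZero 0<s+t}}) ⟩
          (2 ∸ Z) * (s + t) + Z ≡⟨ cong (_+ Z) (⟦n,n⟧ (2 ∸ Z)) ⟨
          ⟦ 2 ∸ Z , 2 ∸ Z ⟧ + Z ≤⟨ +-monoˡ-≤ Z (⟦⟧-mono (2 ∸ Z , 2 ∸ Z) Y 2⊑Y) ⟩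
          ⟦ Y ⟧ + Z             ∎

        large : ⟦ a ⟧ + ⟦ b ⟧ ≤ ⟦ b ⟧ * ⟦ Y ⟧ + c * Z
        large = begin
          ⟦ a ⟧ + ⟦ b ⟧                 ≤⟨ +-monoˡ-≤ ⟦ b ⟧ (⟦⟧-mono a b a⊑b) ⟩
          ⟦ b ⟧ + ⟦ b ⟧                 ≡⟨ cong (⟦ b ⟧ +_) (+-identityʳ ⟦ b ⟧) ⟨
          2 * ⟦ b ⟧                     ≡⟨ *-comm 2 ⟦ b ⟧ ⟩
          ⟦ b ⟧ * 2                     ≤⟨ *-monoʳ-≤ ⟦ b ⟧ 2≤Y+Z ⟩
          ⟦ b ⟧ * (⟦ Y ⟧ + Z)           ≡⟨ *-distribˡ-+ ⟦ b ⟧ ⟦ Y ⟧ Z ⟩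
          ⟦ b ⟧ * ⟦ Y ⟧ + ⟦ b ⟧ * Z     ≤⟨ +-monoʳ-≤ (⟦ b ⟧ * ⟦ Y ⟧) (*-monoˡ-≤ Z b≤c) ⟩
          ⟦ b ⟧ * ⟦ Y ⟧ + c * Z         ∎

    -- Case k = i + 4: with s = Fᵢ₋₃ and t = Fᵢ₋₄ the forms are Lᵢ, Lᵢ₊₂, Fₖ₋₂, Fₖ and Y. As 3 a ≤
    -- f, rows 0 to 2 have only the column z = 0. Column 1 enters row 3 at f - 3 a = `(0 , 1)`.
    certificate-b : 0 < s + t → ∀ {c} → c + ⟦ 8 , 5 ⟧ * ⟦ 7 , 4 ⟧ ≡ ⟦ 21 , 13 ⟧ * ⟦ 18 , 11 ⟧ →
                    Certificate 3 ⟦ 7 , 4 ⟧ ⟦ 18 , 11 ⟧ c ⟦ 8 , 5 ⟧ ⟦ 21 , 13 ⟧ ⟦ 7 , 3 ⟧ 1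
    certificate-b 0<s+t relation =
      certificate 0<s+t (7 , 4) 3 refl ((0 , 0) ∷ (1 , 0) ∷ (2 , 0) ∷ []) inner outer covering
      where
      open Forms (7 , 4) (18 , 11) (8 , 5) (21 , 13) (7 , 3) 1 relation

      inner : ∀ {q z} → q < 3 → Column (7 , 4) q z → (q , z) ∈ (0 , 0) ∷ (1 , 0) ∷ (2 , 0) ∷ []
      inner {0} _ col with column< 0 1 col
      ... | s≤s z≤n = here refl
      inner {1} _ col with column< 1 1 col
      ... | s≤s z≤n = there (here refl)
      inner {2} _ col with column< 2 1 col
      ... | s≤s z≤n = there (there (here refl))
      inner {suc (suc (suc _))} (s≤s (s≤s (s≤s ())))

      outer : ∀ {z} → 1 < z → Column (7 , 4) 3 z → (3 , z) ∈ (0 , 0) ∷ (1 , 0) ∷ (2 , 0) ∷ []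
      outer 1<z col = contradiction (column< 3 2 col) (≤⇒≯ 1<z)

      covering : ∀ {j} → j < ⟦ 7 , 4 ⟧ → Covered j
      covering {j} j<a with j <? ⟦ 0 , 1 ⟧
      ... | yes j<h = let p = on-interval (0 , 0) (0 , 1) 0-minimal j<h in
        covered (p 0 0 ∷ p 1 0 ∷ p 2 0 ∷ p 3 0 ∷ [])
      ... | no j≮l = let p = on-interval (0 , 1) (7 , 4) (≮⇒≥ j≮l) j<a in
        covered (p 0 0 ∷ p 1 0 ∷ p 2 0 ∷ p 3 1 ∷ [])

    -- Case k = i + 3. The threshold `(6 , 4)` is f - a, where column 1 enters row 1. Just below it
    -- the pair (2 , 0) is still needed, and its value there gives g.
    certificate-c : 0 < s + t → ∀ {c} → c + ⟦ 5 , 3 ⟧ * ⟦ 7 , 4 ⟧ ≡ ⟦ 13 , 8 ⟧ * ⟦ 18 , 11 ⟧ →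
                    Certificate 3 ⟦ 7 , 4 ⟧ ⟦ 18 , 11 ⟧ c ⟦ 5 , 3 ⟧ ⟦ 13 , 8 ⟧ ⟦ 20 , 12 ⟧ 0
    certificate-c 0<s+t relation =
      certificate 0<s+t (6 , 4) 2 refl ((0 , 0) ∷ (1 , 0) ∷ (2 , 1) ∷ []) inner outer covering
      where
      open Forms (7 , 4) (18 , 11) (5 , 3) (13 , 8) (20 , 12) 0 relation

      inner : ∀ {q z} → q < 2 → Column (6 , 4) q z → (q , z) ∈ (0 , 0) ∷ (1 , 0) ∷ (2 , 1) ∷ []
      inner {0} _ col with column< 0 1 col
      ... | s≤s z≤n = here refl
      inner {1} _ col with column< 1 1 col
      ... | s≤s z≤n = there (here refl)
      inner {suc (suc _)} (s≤s (s≤s ()))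

      outer : ∀ {z} → 0 < z → Column (6 , 4) 2 z → (2 , z) ∈ (0 , 0) ∷ (1 , 0) ∷ (2 , 1) ∷ []
      outer 0<z col with refl ← ≤-antisym 0<z (s≤s⁻¹ (column< 2 2 col)) = there (there (here refl))

      covering : ∀ {j} → j < ⟦ 7 , 4 ⟧ → Covered j
      covering {j} j<a with j <? ⟦ 6 , 4 ⟧
      ... | yes j<h = let p = on-interval (0 , 0) (6 , 4) 0-minimal j<h in
        covered (p 0 0 ∷ p 1 0 ∷ p 2 0 ∷ p 2 1 ∷ [])
      ... | no j≮l = let p = on-interval (6 , 4) (7 , 4) (≮⇒≥ j≮l) j<a in
        covered (p 0 0 ∷ p 1 0 ∷ p 1 1 ∷ p 2 1 ∷ [])

    -- Case k = i + 2. The thresholds are f - a = `(1 , 1)` for the pair (1 , 1) and 2 f - 2 a =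
    -- `(2 , 2)` for the pair (2 , 2), whose value in the last class gives g.
    certificate-d : 0 < s + t → ∀ {c} → c + ⟦ 3 , 2 ⟧ * ⟦ 7 , 4 ⟧ ≡ ⟦ 8 , 5 ⟧ * ⟦ 18 , 11 ⟧ →
                    Certificate 3 ⟦ 7 , 4 ⟧ ⟦ 18 , 11 ⟧ c ⟦ 3 , 2 ⟧ ⟦ 8 , 5 ⟧ ⟦ 5 , 2 ⟧ 2
    certificate-d 0<s+t relation =
      certificate 0<s+t (7 , 4) 2 refl ((0 , 0) ∷ (1 , 0) ∷ (1 , 1) ∷ []) inner outer covering
      where
      open Forms (7 , 4) (18 , 11) (3 , 2) (8 , 5) (5 , 2) 2 relation

      inner : ∀ {q z} → q < 2 → Column (7 , 4) q z → (q , z) ∈ (0 , 0) ∷ (1 , 0) ∷ (1 , 1) ∷ []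
      inner {0} _ col with column< 0 1 col
      ... | s≤s z≤n = here refl
      inner {1} _ col with column< 1 2 col
      ... | s≤s z≤n = there (here refl)
      ... | s≤s (s≤s z≤n) = there (there (here refl))
      inner {suc (suc _)} (s≤s (s≤s ()))

      outer : ∀ {z} → 2 < z → Column (7 , 4) 2 z → (2 , z) ∈ (0 , 0) ∷ (1 , 0) ∷ (1 , 1) ∷ []
      outer 2<z col = contradiction (column< 2 3 col) (≤⇒≯ 2<z)

      covering : ∀ {j} → j < ⟦ 7 , 4 ⟧ → Covered j
      covering {j} j<a with j <? ⟦ 1 , 1 ⟧ | j <? ⟦ 2 , 2 ⟧
      ... | yes j<h | _ = let p = on-interval (0 , 0) (1 , 1) 0-minimal j<h in
        covered (p 0 0 ∷ p 1 0 ∷ p 2 0 ∷ p 2 1 ∷ [])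
      ... | no j≮l | yes j<h = let p = on-interval (1 , 1) (2 , 2) (≮⇒≥ j≮l) j<h in
        covered (p 0 0 ∷ p 1 0 ∷ p 1 1 ∷ p 2 1 ∷ [])
      ... | _ | no j≮l = let p = on-interval (2 , 2) (7 , 4) (≮⇒≥ j≮l) j<a in
        covered (p 0 0 ∷ p 1 0 ∷ p 1 1 ∷ p 2 2 ∷ [])

    -- Case k = i + 1. The thresholds are 3 f - 2 a, 2 f - a and f, in this order. The value giving
    -- g is that of (2 , 3) just below 2 f - a, where (1 , 2) takes its place.
    certificate-e : 0 < s + t → ∀ {c} → c + ⟦ 2 , 1 ⟧ * ⟦ 7 , 4 ⟧ ≡ ⟦ 5 , 3 ⟧ * ⟦ 18 , 11 ⟧ →
                    Certificate 3 ⟦ 7 , 4 ⟧ ⟦ 18 , 11 ⟧ c ⟦ 2 , 1 ⟧ ⟦ 5 , 3 ⟧ ⟦ 2 , 1 ⟧ 3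
    certificate-e 0<s+t relation =
      certificate 0<s+t (3 , 2) 2 refl ((0 , 0) ∷ (1 , 0) ∷ (1 , 1) ∷ []) inner outer covering
      where
      open Forms (7 , 4) (18 , 11) (2 , 1) (5 , 3) (2 , 1) 3 relation

      inner : ∀ {q z} → q < 2 → Column (3 , 2) q z → (q , z) ∈ (0 , 0) ∷ (1 , 0) ∷ (1 , 1) ∷ []
      inner {0} _ col with column< 0 1 col
      ... | s≤s z≤n = here refl
      inner {1} _ col with column< 1 2 col
      ... | s≤s z≤n = there (here refl)
      ... | s≤s (s≤s z≤n) = there (there (here refl))
      inner {suc (suc _)} (s≤s (s≤s ()))

      outer : ∀ {z} → 3 < z → Column (3 , 2) 2 z → (2 , z) ∈ (0 , 0) ∷ (1 , 0) ∷ (1 , 1) ∷ []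
      outer 3<z col = contradiction (column< 2 4 col) (≤⇒≯ 3<z)

      covering : ∀ {j} → j < ⟦ 7 , 4 ⟧ → Covered j
      covering {j} j<a with j <? ⟦ 1 , 1 ⟧ | j <? ⟦ 3 , 2 ⟧ | j <? ⟦ 5 , 3 ⟧
      ... | yes j<h | _ | _ = let p = on-interval (0 , 0) (1 , 1) 0-minimal j<h in
        covered (p 0 0 ∷ p 1 0 ∷ p 1 1 ∷ p 2 2 ∷ [])
      ... | no j≮l | yes j<h | _ = let p = on-interval (1 , 1) (3 , 2) (≮⇒≥ j≮l) j<h in
        covered (p 0 0 ∷ p 1 0 ∷ p 1 1 ∷ p 2 3 ∷ [])
      ... | _ | no j≮l | yes j<h = let p = on-interval (3 , 2) (5 , 3) (≮⇒≥ j≮l) j<h in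
        covered (p 0 0 ∷ p 1 0 ∷ p 1 1 ∷ p 1 2 ∷ [])
      ... | _ | _ | no j≮l = let p = on-interval (5 , 3) (7 , 4) (≮⇒≥ j≮l) j<a in
        covered (p 0 0 ∷ p 0 1 ∷ p 1 1 ∷ p 1 2 ∷ [])

    -- Case k = i ≥ 4, with s = Fᵢ₋₄ and t = Fᵢ₋₅. The thresholds are f, 4 f - a and 2 f, and Y = 2
    -- a - 4 f. For i = 3 this Y is 0: the pair (1 , 4) is then available in no class below a.
    certificate-f : 0 < s + t → ∀ {c} → c + ⟦ 2 , 1 ⟧ * ⟦ 11 , 7 ⟧ ≡ ⟦ 5 , 3 ⟧ * ⟦ 29 , 18 ⟧ →
                    Certificate 3 ⟦ 11 , 7 ⟧ ⟦ 29 , 18 ⟧ c ⟦ 2 , 1 ⟧ ⟦ 5 , 3 ⟧ ⟦ 2 , 2 ⟧ 4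
    certificate-f 0<s+t relation =
      certificate 0<s+t (11 , 7) 1 refl ((0 , 0) ∷ (0 , 1) ∷ (0 , 2) ∷ []) inner outer covering
      where
      open Forms (11 , 7) (29 , 18) (2 , 1) (5 , 3) (2 , 2) 4 relation

      inner : ∀ {q z} → q < 1 → Column (11 , 7) q z → (q , z) ∈ (0 , 0) ∷ (0 , 1) ∷ (0 , 2) ∷ []
      inner {0} _ col with column< 0 3 col
      ... | s≤s z≤n = here refl
      ... | s≤s (s≤s z≤n) = there (here refl)
      ... | s≤s (s≤s (s≤s z≤n)) = there (there (here refl))
      inner {suc _} (s≤s ())

      outer : ∀ {z} → 4 < z → Column (11 , 7) 1 z → (1 , z) ∈ (0 , 0) ∷ (0 , 1) ∷ (0 , 2) ∷ []
      outer 4<z col = contradiction (column< 1 5 col) (≤⇒≯ 4<z)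

      covering : ∀ {j} → j < ⟦ 11 , 7 ⟧ → Covered j
      covering {j} j<a with j <? ⟦ 5 , 3 ⟧ | j <? ⟦ 9 , 5 ⟧ | j <? ⟦ 10 , 6 ⟧
      ... | yes j<h | _ | _ = let p = on-interval (0 , 0) (5 , 3) 0-minimal j<h in
        covered (p 0 0 ∷ p 1 0 ∷ p 1 1 ∷ p 1 2 ∷ [])
      ... | no j≮l | yes j<h | _ = let p = on-interval (5 , 3) (9 , 5) (≮⇒≥ j≮l) j<h in
        covered (p 0 0 ∷ p 0 1 ∷ p 1 2 ∷ p 1 3 ∷ [])
      ... | _ | no j≮l | yes j<h = let p = on-interval (9 , 5) (10 , 6) (≮⇒≥ j≮l) j<h in
        covered (p 0 0 ∷ p 0 1 ∷ p 1 3 ∷ p 1 4 ∷ [])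
      ... | _ | _ | no j≮l = let p = on-interval (10 , 6) (11 , 7) (≮⇒≥ j≮l) j<a in
        covered (p 0 0 ∷ p 0 1 ∷ p 0 2 ∷ p 1 4 ∷ [])

    -- Only for s = 1 and t = 0 (i = k = 3): a = 4, b = 11, e = 1, f = 2, Y = 4.
    certificate-f₃ : 0 < s + t → ∀ {c} → c + ⟦ 1 , 1 ⟧ * ⟦ 4 , 4 ⟧ ≡ ⟦ 2 , 2 ⟧ * ⟦ 11 , 11 ⟧ →
                    Certificate 3 ⟦ 4 , 4 ⟧ ⟦ 11 , 11 ⟧ c ⟦ 1 , 1 ⟧ ⟦ 2 , 2 ⟧ ⟦ 4 , 4 ⟧ 2
    certificate-f₃ 0<s+t relation =
      certificate 0<s+t (4 , 4) 1 refl ((0 , 0) ∷ (0 , 1) ∷ (1 , 3) ∷ []) inner outer covering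
      where
      open Forms (4 , 4) (11 , 11) (1 , 1) (2 , 2) (4 , 4) 2 relation

      inner : ∀ {q z} → q < 1 → Column (4 , 4) q z → (q , z) ∈ (0 , 0) ∷ (0 , 1) ∷ (1 , 3) ∷ []
      inner {0} _ col with column< 0 2 col
      ... | s≤s z≤n = here refl
      ... | s≤s (s≤s z≤n) = there (here refl)
      inner {suc _} (s≤s ())

      outer : ∀ {z} → 2 < z → Column (4 , 4) 1 z → (1 , z) ∈ (0 , 0) ∷ (0 , 1) ∷ (1 , 3) ∷ []
      outer 2<z col with refl ← ≤-antisym 2<z (s≤s⁻¹ (column< 1 4 col)) = there (there (here refl))

      covering : ∀ {j} → j < ⟦ 4 , 4 ⟧ → Covered j
      covering {j} j<a with j <? ⟦ 2 , 2 ⟧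
      ... | yes j<h = let p = on-interval (0 , 0) (2 , 2) 0-minimal j<h in
        covered (p 0 0 ∷ p 1 0 ∷ p 1 1 ∷ p 1 2 ∷ [])
      ... | no j≮l = let p = on-interval (2 , 2) (4 , 4) (≮⇒≥ j≮l) j<a in
        covered (p 0 0 ∷ p 0 1 ∷ p 1 2 ∷ p 1 3 ∷ [])

-- Certificates for large k and for k below i.

module NumericCertificates where
  open import Data.Nat.Base
  open import Data.Nat.Properties
  open import Data.Nat.Tactic.RingSolver using (solve; solve-∀)
  open import Data.List.Base using (List; []; _∷_; length)
  open import Data.List.Membership.Propositional using (_∈_)
  open import Data.List.Relation.Unary.All as All using (All)
  open import Data.List.Relation.Unary.Any using (here; there)
  open import Data.List.Relation.Unary.Unique.Propositional using (Unique)
  import Data.List.Relation.Unary.AllPairs as AllPairs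
  open import Data.Product.Base using (∃-syntax; _×_; _,_)
  open import Data.Sum.Base using (_⊎_; inj₁; inj₂)
  open import Relation.Binary.PropositionalEquality hiding (J)
  open import Relation.Nullary.Decidable using (yes; no)
  open import Relation.Nullary.Negation using (contradiction)
  open Covering
  open Frobenius
  open Residues
  open Values

  four : ∀ {A : Set} {P : A → Set} {w x y z} → w ≢ x → w ≢ y → w ≢ z → x ≢ y → x ≢ z → y ≢ z →
         P w → P x → P y → P z → ∃[ ps ] (Unique ps × 3 < length ps × All P ps)
  four wx wy wz xy xz yz pw px py pz =
    _ , (wx All.∷ wy All.∷ wz All.∷ All.[]) AllPairs.∷ (xy All.∷ xz All.∷ All.[]) AllPairs.∷
        (yz All.∷ All.[]) AllPairs.∷ All.[] AllPairs.∷ AllPairs.[]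
      , s≤s (s≤s (s≤s (s≤s z≤n))) , pw All.∷ px All.∷ py All.∷ pz All.∷ All.[]

  -- When f ≥ 4 a no column z ≥ 1 fits into rows 0 to 3, so the same four pairs on z = 0 serve every
  -- class and j = a - 1 is the worst.
  certificate-a : ∀ {a b c e f} → c + e * a ≡ f * b → 0 < a → a ≤ b → 4 * a ≤ f → e * (4 * a) ≤ c →
                  Certificate 3 a b c e f (4 * a) 0
  certificate-a {a} {b} {c} {e} {f} relation 0<a a≤b 4a≤f steep = record
    { relation   = relation
    ; J          = a
    ; Q          = 3
    ; 0<J        = 0<a
    ; J≤a        = ≤-refl
    ; top        = solve (a ∷ f ∷ [])
    ; steep      = steep
    ; large      = large
    ; exceptions = (0 , 0) ∷ (1 , 0) ∷ (2 , 0) ∷ []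
    ; few        = ≤-refl
    ; exhaustive = exhaustive
    ; covering   = λ j<a → four (λ ()) (λ ()) (λ ()) (λ ()) (λ ()) (λ ())
                             (on-axis j<a 0 z≤n) (on-axis j<a 1 (s≤s z≤n)) (on-axis j<a 2 (s≤s (s≤s z≤n)))
                             (on-axis j<a 3 ≤-refl)
    }
    where
    open ≤-Reasoning

    large : a + b ≤ b * (4 * a) + c * 0
    large = begin
      a + b                 ≤⟨ +-monoˡ-≤ b a≤b ⟩
      b + b                 ≤⟨ m≤m+n (b + b) (b + b) ⟩
      b + b + (b + b)       ≡⟨ solve (b ∷ []) ⟩
      b * (4 * 1)           ≤⟨ *-monoʳ-≤ b (*-monoʳ-≤ 4 0<a) ⟩
      b * (4 * a)           ≤⟨ m≤m+n _ (c * 0) ⟩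
      b * (4 * a) + c * 0   ∎

    row : ∀ {q} → q ≤ 3 → a + q * a ≤ f * 1
    row {q} q≤3 = begin
      suc q * a   ≤⟨ *-monoˡ-≤ a (s≤s q≤3) ⟩
      4 * a       ≤⟨ 4a≤f ⟩
      f           ≡⟨ *-identityʳ f ⟨
      f * 1       ∎

    exhaustive : ∀ {y z q} → suc (y + f * z) ≡ a + q * a → q < 3 ⊎ (q ≡ 3 × 0 < z) →
                 (q , z) ∈ (0 , 0) ∷ (1 , 0) ∷ (2 , 0) ∷ []
    exhaustive {y} {z} {q} eq (inj₁ q<3) with column {f} {1} {y} eq (row (<⇒≤ q<3))
    exhaustive {q = 0} _ (inj₁ _) | s≤s z≤n = here refl
    exhaustive {q = 1} _ (inj₁ _) | s≤s z≤n = there (here refl)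
    exhaustive {q = 2} _ (inj₁ _) | s≤s z≤n = there (there (here refl))
    exhaustive {q = suc (suc (suc _))} _ (inj₁ (s≤s (s≤s (s≤s ())))) | _
    exhaustive {y} eq (inj₂ (refl , 0<z)) = contradiction (column {f} {1} {y} eq (row ≤-refl)) (≤⇒≯ 0<z)

    on-axis : ∀ {j} → j < a → ∀ q → q ≤ 3 → Point a b c f (b * (4 * a) + c * 0) j (q , 0)
    on-axis {j} j<a q q≤3 = mkPoint (j + q * a) (solve (a ∷ f ∷ j ∷ q ∷ [])) (begin
      b * suc (j + q * a) + c * 0   ≤⟨ +-monoˡ-≤ (c * 0) (*-monoʳ-≤ b (+-mono-≤ j<a (*-monoˡ-≤ a q≤3))) ⟩
      b * (4 * a) + c * 0           ∎)

  private
    slide-eq : ∀ f x z i → x + f * i + f * z ≡ x + f * (z + i)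
    slide-eq = solve-∀

    column-eq : ∀ y ρ f r z → y + ρ + f * (3 + (r + z)) ≡ y + f * z + 1 * (ρ + f * (3 + r))
    column-eq = solve-∀

    level-eq : ∀ r z l → 3 + (r + z) + l ≡ 3 + (z + l) + r
    level-eq = solve-∀

  module _ {a b c e f r ρ : ℕ} (relation : c + e * a ≡ f * b) (a≡ : a ≡ ρ + f * (3 + r)) (ρ≤f : ρ ≤ f)
           (2≤f : 2 ≤ f) (0<a : 0 < a) (a≤b : a ≤ b) (ea≤c : e * a ≤ c) (ef≤c : e * f ≤ c) where

    -- The quotient of the theorem is `3 + r`. The two corner hypotheses are the two candidates for
    -- the worst case: y + 1 = f at level 5 + r, and y + 1 = ρ at level 6 + r after a carry. The
    -- level of a pair is its column plus an allowance of c for each slide; `Y` and `Z` are to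
    -- describe the larger candidate.
    certificate-g : ∀ {J Y Z} → 2 ≤ Z → Y ≤ f → 0 < J → J ≤ 3 * f → J + 1 * a ≡ Y + f * Z →
                    b * f + c * (5 + r) ≤ b * Y + c * Z → b * ρ + c * (6 + r) ≤ b * Y + c * Z →
                    Certificate 3 a b c e f Y Z
    certificate-g {J} {Y} {Z} 2≤Z Y≤f 0<J J≤3f top corner corner′ = record
      { relation   = relation
      ; J          = J
      ; Q          = 1
      ; 0<J        = 0<J
      ; J≤a        = begin
          J                 ≤⟨ J≤3f ⟩
          3 * f             ≡⟨ *-comm 3 f ⟩
          f * 3             ≤⟨ *-monoʳ-≤ f (m≤m+n 3 r) ⟩
          f * (3 + r)       ≤⟨ m≤n+m _ ρ ⟩
          ρ + f * (3 + r)   ≡⟨ a≡ ⟨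
          a                 ∎
      ; top        = top
      ; steep      = ≤-trans (*-monoʳ-≤ e Y≤f) ef≤c
      ; large      = large
      ; exceptions = (0 , 0) ∷ (0 , 1) ∷ (0 , 2) ∷ []
      ; few        = ≤-refl
      ; exhaustive = exhaustive
      ; covering   = covering
      }
      where
      open ≤-Reasoning

      instance
        f≢0 : NonZero f
        f≢0 = >-nonZero (≤-trans (s≤s z≤n) 2≤f)

      T : ℕ
      T = b * Y + c * Z

      bf≤2c : b * f ≤ 2 * c
      bf≤2c = begin
        b * f         ≡⟨ *-comm b f ⟩
        f * b         ≡⟨ relation ⟨
        c + e * a     ≤⟨ +-monoʳ-≤ c ea≤c ⟩
        c + c         ≡⟨ cong (c +_) (+-identityʳ c) ⟨
        2 * c         ∎

      b≤c : b ≤ c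
      b≤c = *-cancelˡ-≤ 2 (begin
        2 * b   ≤⟨ *-monoˡ-≤ b 2≤f ⟩
        f * b   ≡⟨ *-comm f b ⟩
        b * f   ≤⟨ bf≤2c ⟩
        2 * c   ∎)

      large : a + b ≤ T
      large = begin
        a + b     ≤⟨ +-mono-≤ (≤-trans a≤b b≤c) b≤c ⟩
        c + c     ≡⟨ solve (c ∷ []) ⟩
        c * 2     ≤⟨ *-monoʳ-≤ c 2≤Z ⟩
        c * Z     ≤⟨ m≤n+m _ (b * Y) ⟩
        T         ∎

      exhaustive : ∀ {y z q} → suc (y + f * z) ≡ J + q * a → q < 1 ⊎ (q ≡ 1 × Z < z) →
                   (q , z) ∈ (0 , 0) ∷ (0 , 1) ∷ (0 , 2) ∷ []
      exhaustive {y} {z} {0} eq _ with column {f} {3} {y} (trans eq (+-identityʳ J)) (≤-trans J≤3f (≤-reflexive (*-comm 3 f)))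
      ... | s≤s z≤n             = here refl
      ... | s≤s (s≤s z≤n)       = there (here refl)
      ... | s≤s (s≤s (s≤s z≤n)) = there (there (here refl))
      exhaustive {q = suc _} _ (inj₁ (s≤s ()))
      exhaustive {y} eq (inj₂ (refl , Z<z)) = contradiction
        (column {f} {suc Z} {y} (trans eq top) (≤-trans (+-monoˡ-≤ (f * Z) Y≤f) (≤-reflexive (sym (*-suc f Z)))))
        (≤⇒≯ Z<z)

      -- Trading one z for f units of y costs b f − c ≤ c.
      slide : ∀ {j q x} z i → x + f * (z + i) ≡ j + q * a → b * suc x + c * (z + 2 * i) ≤ T →
              Point a b c f T j (q , z)
      slide {j} {q} {x} z i eq le = mkPoint (x + f * i) (trans (slide-eq f x z i) eq) (begin
        b * suc (x + f * i) + c * z               ≡⟨ solve (b ∷ c ∷ f ∷ x ∷ z ∷ i ∷ []) ⟩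
        b * suc x + c * z + i * (b * f)           ≤⟨ +-monoʳ-≤ _ (*-monoʳ-≤ i bf≤2c) ⟩
        b * suc x + c * z + i * (2 * c)           ≡⟨ solve (b ∷ c ∷ x ∷ z ∷ i ∷ []) ⟩
        b * suc x + c * (z + 2 * i)               ≤⟨ le ⟩
        T                                         ∎)

      inside : ∀ {x X} → x < f → X ≤ 5 + r → b * suc x + c * X ≤ T
      inside x<f X≤ = ≤-trans (+-mono-≤ (*-monoʳ-≤ b x<f) (*-monoʳ-≤ c X≤)) corner

      inside′ : ∀ {x X} → x < ρ → X ≤ 6 + r → b * suc x + c * X ≤ T
      inside′ x<ρ X≤ = ≤-trans (+-mono-≤ (*-monoʳ-≤ b x<ρ) (*-monoʳ-≤ c X≤)) corner′

      -- The top entry (x , 3 + X) of the column q = 1 in the class of y₀ + f z₀.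
      next-column : ∀ {y₀} → y₀ < f → ∀ z₀ l → z₀ + l ≡ 2 →
                    ∃[ x ] ∃[ X ] (x + f * (3 + X) ≡ y₀ + f * z₀ + 1 * a × b * suc x + c * (3 + X + l) ≤ T)
      next-column {y₀} y₀<f z₀ l z₀+l≡2 with y₀ + ρ <? f
      ... | yes x<f = y₀ + ρ , r + z₀
                    , trans (column-eq y₀ ρ f r z₀) (cong (λ k → y₀ + f * z₀ + 1 * k) (sym a≡))
                    , inside x<f (≤-reflexive (trans (level-eq r z₀ l) (cong (λ k → 3 + k + r) z₀+l≡2)))
      -- A carry: the column rises by one, and what is left of y is below ρ because y₀ < f.
      ... | no x≮f = x , suc (r + z₀) , eq
                   , inside′ x<ρ (≤-reflexive (trans (cong suc (level-eq r z₀ l)) (cong (λ k → 4 + k + r) z₀+l≡2)))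
        where
        x = y₀ + ρ ∸ f
        x+f≡ : x + f ≡ y₀ + ρ
        x+f≡ = m∸n+n≡m (≮⇒≥ x≮f)
        x<ρ : x < ρ
        x<ρ = +-cancelʳ-< f x ρ (begin-strict
          x + f     ≡⟨ x+f≡ ⟩
          y₀ + ρ    <⟨ +-monoˡ-< ρ y₀<f ⟩
          f + ρ     ≡⟨ +-comm f ρ ⟩
          ρ + f     ∎)
        regroup : ∀ f r z₀ x → x + f * (3 + suc (r + z₀)) ≡ x + f + f * (3 + r + z₀)
        regroup = solve-∀
        eq : x + f * (3 + suc (r + z₀)) ≡ y₀ + f * z₀ + 1 * a
        eq = begin-equality
          x + f * (3 + suc (r + z₀))              ≡⟨ regroup f r z₀ x ⟩
          x + f + f * (3 + r + z₀)                ≡⟨ cong (_+ f * (3 + r + z₀)) x+f≡ ⟩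
          y₀ + ρ + f * (3 + r + z₀)               ≡⟨ solve (f ∷ y₀ ∷ ρ ∷ r ∷ z₀ ∷ []) ⟩
          y₀ + f * z₀ + 1 * (ρ + f * (3 + r))     ≡⟨ cong (λ k → y₀ + f * z₀ + 1 * k) a≡ ⟨
          y₀ + f * z₀ + 1 * a                     ∎

      -- Row 0 is slid at most three times, hence the summand 3. From j < a follows z₀ ≤ 3 + r, with
      -- equality only for y₀ < ρ, so both corners occur again.
      first-column : ∀ {y₀} z₀ → y₀ < f → y₀ + f * z₀ < a → b * suc y₀ + c * (z₀ + 3) ≤ T
      first-column {y₀} z₀ y₀<f j<a with z₀ <? 3 + r
      ... | yes z₀<3+r = inside y₀<f (≤-trans (+-monoˡ-≤ 3 (s≤s⁻¹ z₀<3+r)) (≤-reflexive (cong (2 +_) (+-comm r 3))))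
      ... | no  z₀≮3+r = inside′ y₀<ρ (≤-trans (+-monoˡ-≤ 3 z₀≤3+r) (≤-reflexive (cong (3 +_) (+-comm r 3))))
        where
        y₀<ρ : y₀ < ρ
        y₀<ρ = +-cancelʳ-< (f * (3 + r)) y₀ ρ (≤-<-trans (+-monoʳ-≤ y₀ (*-monoʳ-≤ f (≮⇒≥ z₀≮3+r))) (subst (y₀ + f * z₀ <_) a≡ j<a))
        z₀≤3+r : z₀ ≤ 3 + r
        z₀≤3+r = s≤s⁻¹ (*-cancelˡ-< f z₀ (4 + r) (begin-strict
          f * z₀            ≤⟨ m≤n+m _ y₀ ⟩
          y₀ + f * z₀       <⟨ j<a ⟩
          a                 ≡⟨ a≡ ⟩
          ρ + f * (3 + r)   ≤⟨ +-monoˡ-≤ _ ρ≤f ⟩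
          f + f * (3 + r)   ≡⟨ *-suc f (3 + r) ⟨
          f * (4 + r)       ∎))

      -- Row 0 offers the columns from z₀ downwards. If z₀ ≤ 2, the missing 3 - z₀ pairs come from
      -- the top of row 1, which takes at most l = 2 - z₀ slides; hence `z₀ + l ≡ 2` in
      -- `next-column`.
      covering′ : ∀ {y₀} z₀ → y₀ < f → y₀ + f * z₀ < a →
                  ∃[ qzs ] (Unique qzs × 3 < length qzs × All (Point a b c f T (y₀ + f * z₀)) qzs)
      covering′ {y₀} z₀ y₀<f j<a = cover z₀ (first-column z₀ y₀<f j<a)
        where
        first : ∀ z i {n} → z + i ≡ n → i ≤ 3 → b * suc y₀ + c * (n + 3) ≤ T → Point a b c f T (y₀ + f * n) (0 , z)
        first z i refl i≤3 le = slide z i (sym (+-identityʳ _)) (≤-trans (+-monoʳ-≤ (b * suc y₀) (*-monoʳ-≤ c (begin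
          z + 2 * i       ≡⟨ solve (z ∷ i ∷ []) ⟩
          z + i + i       ≤⟨ +-monoʳ-≤ (z + i) i≤3 ⟩
          z + i + 3       ∎))) le)

        second : ∀ {n x X l} z i → z + i ≡ 3 + X → i ≤ l → x + f * (3 + X) ≡ y₀ + f * n + 1 * a →
                 b * suc x + c * (3 + X + l) ≤ T → Point a b c f T (y₀ + f * n) (1 , z)
        second {n} {x} {X} {l} z i z+i≡ i≤l eq le = slide z i (trans (cong (λ k → x + f * k) z+i≡) eq)
          (≤-trans (+-monoʳ-≤ (b * suc x) (*-monoʳ-≤ c (begin
            z + 2 * i       ≡⟨ solve (z ∷ i ∷ []) ⟩
            z + i + i       ≤⟨ +-mono-≤ (≤-reflexive z+i≡) i≤l ⟩
            3 + X + l       ∎))) le)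

        cover : ∀ n → b * suc y₀ + c * (n + 3) ≤ T →
                ∃[ qzs ] (Unique qzs × 3 < length qzs × All (Point a b c f T (y₀ + f * n)) qzs)
        cover 0 le with next-column y₀<f 0 2 refl
        ... | x , X , eq , le′ =
             four (λ ()) (λ ()) (λ ()) (λ ()) (λ ()) (λ ()) (first 0 0 refl z≤n le)
               (second (1 + X) 2 (+-comm (1 + X) 2) ≤-refl eq le′)
               (second (2 + X) 1 (+-comm (2 + X) 1) (s≤s z≤n) eq le′)
               (second (3 + X) 0 (+-identityʳ (3 + X)) z≤n eq le′)
        cover 1 le with next-column y₀<f 1 1 refl
        ... | x , X , eq , le′ =
             four (λ ()) (λ ()) (λ ()) (λ ()) (λ ()) (λ ()) (first 0 1 refl (s≤s z≤n) le) (first 1 0 refl z≤n le)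
               (second (2 + X) 1 (+-comm (2 + X) 1) ≤-refl eq le′)
               (second (3 + X) 0 (+-identityʳ (3 + X)) z≤n eq le′)
        cover 2 le with next-column y₀<f 2 0 refl
        ... | x , X , eq , le′ =
             four (λ ()) (λ ()) (λ ()) (λ ()) (λ ()) (λ ())
               (first 0 2 refl (s≤s (s≤s z≤n)) le) (first 1 1 refl (s≤s z≤n) le) (first 2 0 refl z≤n le)
               (second (3 + X) 0 (+-identityʳ (3 + X)) z≤n eq le′)
        cover (suc (suc (suc z))) le =
          four (λ ()) (λ ()) (λ ()) (λ ()) (λ ()) (λ ())
            (first z 3 (+-comm z 3) ≤-refl le)
            (first (1 + z) 2 (+-comm (1 + z) 2) (s≤s (s≤s z≤n)) le)
            (first (2 + z) 1 (+-comm (2 + z) 1) (s≤s z≤n) le)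
            (first (3 + z) 0 (+-identityʳ (3 + z)) z≤n le)

      covering : ∀ {j} → j < a → ∃[ qzs ] (Unique qzs × 3 < length qzs × All (Point a b c f T j) qzs)
      covering {j} j<a with quotient-remainder f j
      ... | y₀ , z₀ , y₀<f , j≡ with refl ← trans j≡ (cong (y₀ +_) (*-comm z₀ f)) = covering′ z₀ y₀<f j<a

-- Fibonacci and Lucas identities, and the certificates specialised to them.

module FibonacciLucas where
  open import Data.Nat.Base
  open import Data.Nat.Properties
  open import Data.Nat.Coprimality using (Coprime)
  open import Data.Nat.Divisibility using (_∣_; _∣0; ∣1⇒≡1)
  open import Data.Nat.DivMod using (_/_; _%_; m≡m%n+[m/n]*n; m%n<n; m*n/n≡m; /-monoˡ-≤)
  open import Data.Nat.GCD using (gcd-greatest)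
  open import Data.Nat.Tactic.RingSolver using (solve-∀)
  open import Data.Product.Base using (∃-syntax; _×_; _,_)
  open import Function.Bundles using (_⇔_; mk⇔)
  open import Relation.Binary.PropositionalEquality
  open Frobenius using (Certificate)
  open NumericCertificates using (certificate-a; certificate-g)
  open LinearForms

  fib-mono : ∀ {m n} → m ≤ n → fib m ≤ fib n
  fib-mono {m} m≤n = go (≤⇒≤′ m≤n)
    where
    step : ∀ n → fib n ≤ fib (suc n)
    step zero    = z≤n
    step (suc n) = m≤m+n (fib (suc n)) (fib n)
    go : ∀ {n} → m ≤′ n → fib m ≤ fib n
    go (≤′-reflexive refl) = ≤-refl
    go (≤′-step {n} m≤n)   = ≤-trans (go m≤n) (step n)

  lucas-fib : ∀ n → lucas (suc n) ≡ fib (suc n) + 2 * fib n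
  lucas-fib 0             = refl
  lucas-fib 1             = refl
  lucas-fib (suc (suc n)) = trans (cong₂ _+_ (lucas-fib (suc n)) (lucas-fib n))
    (regroup (fib (2 + n)) (fib (1 + n)) (fib n))
    where
    regroup : ∀ x y z → x + 2 * y + (y + 2 * z) ≡ x + y + 2 * (y + z)
    regroup = solve-∀

  -- Both sides obey the Fibonacci recurrence in k, so k = 0 and k = 1 suffice. This is the relation
  -- c + e a = f b, with k shifted by two.
  lucas-shift : ∀ i k → lucas (2 + k + i) + fib k * lucas i ≡ fib (2 + k) * lucas (2 + i)
  lucas-shift i 0 = trans (+-identityʳ _) (sym (+-identityʳ _))
  lucas-shift i 1 = regroup (lucas i) (lucas (1 + i))
    where
    regroup : ∀ x y → y + x + y + 1 * x ≡ 2 * (y + x)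
    regroup = solve-∀
  lucas-shift i (suc (suc k)) = begin
    lucas (3 + k + i) + lucas (2 + k + i) + (fib (1 + k) + fib k) * lucas i
      ≡⟨ regroup (lucas (3 + k + i)) (lucas (2 + k + i)) (fib (1 + k)) (fib k) (lucas i) ⟩
    lucas (3 + k + i) + fib (1 + k) * lucas i + (lucas (2 + k + i) + fib k * lucas i)
      ≡⟨ cong₂ _+_ (lucas-shift i (suc k)) (lucas-shift i k) ⟩
    fib (3 + k) * lucas (2 + i) + fib (2 + k) * lucas (2 + i)
      ≡⟨ *-distribʳ-+ (lucas (2 + i)) (fib (3 + k)) (fib (2 + k)) ⟨
    fib (4 + k) * lucas (2 + i) ∎
    where
    open ≡-Reasoning
    regroup : ∀ u v x y z → u + v + (x + y) * z ≡ u + x * z + (v + y * z)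
    regroup = solve-∀

  2lucas≤lucas : ∀ i → 2 * lucas (suc i) ≤ lucas (3 + i)
  2lucas≤lucas i = subst (2 * lucas (suc i) ≤_) (regroup (lucas (1 + i)) (lucas i)) (m≤m+n (2 * lucas (suc i)) (lucas i))
    where
    regroup : ∀ x y → 2 * x + y ≡ x + y + x
    regroup = solve-∀

  -- Read off from the triple whose third generator repeats the first.
  lucas-coprime : ∀ i → Coprime (lucas i) (lucas (i + 2))
  lucas-coprime i {d} (d∣a , d∣b) = ∣1⇒≡1 (subst (d ∣_) (Generators.coprime (lucasTriple i i))
    (gcd-greatest d∣a (gcd-greatest d∣b (gcd-greatest d∣a (d ∣0)))))

  -- Coefficients of Fₘ₊ₙ with respect to Fₙ and Fₙ₊₁ - Fₙ.
  fibForm : ℕ → Form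
  fibForm 0             = 1 , 0
  fibForm 1             = 1 , 1
  fibForm (suc (suc m)) = fibForm (suc m) ⊕ fibForm m

  lucasForm : ℕ → Form
  lucasForm m = fibForm (suc m) ⊕ 2 ⊙ fibForm m

  module _ (n : ℕ) where
    -- For n > 0 the second parameter is fib (n ∸ 1); for n = 0 it is fib (−1) = 1.
    private
      s t : ℕ
      s = fib n
      t = fib (suc n) ∸ fib n

      s+t≡ : s + t ≡ fib (suc n)
      s+t≡ = m+[n∸m]≡n (fib-mono (n≤1+n n))

    open Evaluation s t public

    0<s+t : 0 < s + t
    0<s+t = subst (0 <_) (sym s+t≡) (0<fib n)

    ⟦fib⟧ : ∀ m → ⟦ fibForm m ⟧ ≡ fib (m + n)
    ⟦fib⟧ 0             = trans (⟦⟧-def 1 0) (trans (+-identityʳ (1 * s)) (*-identityˡ s))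
    ⟦fib⟧ 1             = trans (⟦n,n⟧ 1) (trans (*-identityˡ (s + t)) s+t≡)
    ⟦fib⟧ (suc (suc m)) = trans (⟦⊕⟧ (fibForm (suc m)) (fibForm m)) (cong₂ _+_ (⟦fib⟧ (suc m)) (⟦fib⟧ m))

    ⟦lucas⟧ : ∀ m → ⟦ lucasForm m ⟧ ≡ lucas (suc m + n)
    ⟦lucas⟧ m = begin
      ⟦ fibForm (suc m) ⊕ 2 ⊙ fibForm m ⟧     ≡⟨ ⟦⊕⟧ (fibForm (suc m)) (2 ⊙ fibForm m) ⟩
      ⟦ fibForm (suc m) ⟧ + ⟦ 2 ⊙ fibForm m ⟧ ≡⟨ cong₂ _+_ (⟦fib⟧ (suc m)) (trans (⟦⊙⟧ 2 (fibForm m)) (cong (2 *_) (⟦fib⟧ m))) ⟩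
      fib (suc m + n) + 2 * fib (m + n)       ≡⟨ lucas-fib (m + n) ⟨
      lucas (suc m + n)                       ∎
      where open ≡-Reasoning

    ⟦shift⟧ : ∀ h k {m} → m ≡ 2 + (k + n) + (suc h + n) →
              lucas m + ⟦ fibForm k ⟧ * ⟦ lucasForm h ⟧ ≡ ⟦ fibForm (2 + k) ⟧ * ⟦ lucasForm (2 + h) ⟧
    ⟦shift⟧ h k refl = begin
      lucas (2 + (k + n) + (suc h + n)) + ⟦ fibForm k ⟧ * ⟦ lucasForm h ⟧
        ≡⟨ cong₂ (λ x y → lucas (2 + (k + n) + (suc h + n)) + x * y) (⟦fib⟧ k) (⟦lucas⟧ h) ⟩
      lucas (2 + (k + n) + (suc h + n)) + fib (k + n) * lucas (suc h + n)
        ≡⟨ lucas-shift (suc h + n) (k + n) ⟩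
      fib (2 + (k + n)) * lucas (2 + (suc h + n))
        ≡⟨ cong₂ _*_ (⟦fib⟧ (2 + k)) (⟦lucas⟧ (2 + h)) ⟨
      ⟦ fibForm (2 + k) ⟧ * ⟦ lucasForm (2 + h) ⟧ ∎
      where open ≡-Reasoning

  -- In coefficients, 4 Lᵢ is (28 , 16) and Fᵢ₊₅ is (34 , 21), while Fᵢ₊₄ is only (21 , 13); this is
  -- the origin of the bound k ≥ i + 5.
  4lucas≤fib : ∀ n {k} → (3 + n) + 5 ≤ k → 4 * lucas (3 + n) ≤ fib k
  4lucas≤fib n {k} i+5≤k = begin
    4 * lucas (3 + n)       ≡⟨ cong (4 *_) (⟦lucas⟧ n 2) ⟨
    4 * ⟦_⟧ n (7 , 4)       ≡⟨ ⟦⊙⟧ n 4 (7 , 4) ⟨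
    ⟦_⟧ n (28 , 16)         ≤⟨ ⟦⟧-mono n (28 , 16) (fibForm 8) _ ⟩
    ⟦_⟧ n (fibForm 8)       ≡⟨ ⟦fib⟧ n 8 ⟩
    fib (8 + n)             ≤⟨ fib-mono (≤-trans (≤-reflexive (+-comm 5 (3 + n))) i+5≤k) ⟩
    fib k                   ∎
    where open ≤-Reasoning

  -- For m = k + 1 ≥ 2 one has Fₘ₊₂ = 2 Fₘ + Fₘ₋₁ and Fₘ ≤ 2 Fₘ₋₁.
  5fib≤2fib : ∀ {k} → 1 ≤ k → 5 * fib (suc k) ≤ 2 * fib (3 + k)
  5fib≤2fib {suc k} _ = begin
    5 * fib (2 + k)                         ≡⟨ *-distribʳ-+ (fib (2 + k)) 1 4 ⟩
    1 * fib (2 + k) + 4 * fib (2 + k)       ≤⟨ +-monoˡ-≤ (4 * fib (2 + k)) (begin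
      1 * fib (2 + k)             ≡⟨ *-identityˡ (fib (2 + k)) ⟩
      fib (1 + k) + fib k         ≤⟨ +-monoʳ-≤ (fib (1 + k)) (fib-mono (n≤1+n k)) ⟩
      fib (1 + k) + fib (1 + k)   ≡⟨ cong (fib (1 + k) +_) (+-identityʳ (fib (1 + k))) ⟨
      2 * fib (1 + k)             ∎) ⟩
    2 * fib (1 + k) + 4 * fib (2 + k)       ≡⟨ regroup (fib (1 + k)) (fib (2 + k)) ⟩
    2 * fib (4 + k)                         ∎
    where
    open ≤-Reasoning
    regroup : ∀ x y → 2 * x + 4 * y ≡ 2 * (y + x + y)
    regroup = solve-∀

  lucas-certificate-a : ∀ n {k} → (3 + n) + 5 ≤ 2 + suc k →
    Certificate 3 (lucas (3 + n)) (lucas (5 + n)) (lucas (2 + suc k + (3 + n))) (fib (suc k)) (fib (2 + suc k)) (4 * lucas (3 + n)) 0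
  lucas-certificate-a n {k} i+5≤k = certificate-a relation (0<lucas (3 + n))
    (≤-trans (m≤m+n a (a + 0)) 2a≤b) (4lucas≤fib n i+5≤k)
    -- Steepness 4 e a ≤ c = f b - e a amounts to 5 e a ≤ f b, which is half the product of 5 e ≤ 2
    -- f and 2 a ≤ b.
    (+-cancelʳ-≤ (e * a) _ _ (*-cancelˡ-≤ 2 (begin
      2 * (e * (4 * a) + e * a)     ≡⟨ regroup e a ⟩
      5 * e * (2 * a)               ≤⟨ *-mono-≤ 5e≤2f 2a≤b ⟩
      2 * f * b                     ≡⟨ *-assoc 2 f b ⟩
      2 * (f * b)                   ≡⟨ cong (2 *_) relation ⟨
      2 * (c + e * a)               ∎)))
    where
    open ≤-Reasoning
    a = lucas (3 + n)
    b = lucas (5 + n)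
    c = lucas (2 + suc k + (3 + n))
    e = fib (suc k)
    f = fib (2 + suc k)
    relation : c + e * a ≡ f * b
    relation = lucas-shift (3 + n) (suc k)
    2a≤b : 2 * a ≤ b
    2a≤b = 2lucas≤lucas (2 + n)
    regroup : ∀ e a → 2 * (e * (4 * a) + e * a) ≡ 5 * e * (2 * a)
    regroup = solve-∀
    5e≤2f : 5 * e ≤ 2 * f
    5e≤2f = 5fib≤2fib (≤-trans (m≤n+m 1 (n + 4)) (≤-trans (≤-reflexive (+-assoc n 4 1)) (s≤s⁻¹ (s≤s⁻¹ (s≤s⁻¹ i+5≤k)))))

  module _ (n k : ℕ) (1≤k : 1 ≤ k) where
    private
      a = lucas (3 + n)
      b = lucas (5 + n)
      c = lucas (2 + k + (3 + n))
      e = fib k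
      f = fib (2 + k)

      instance
        f≢0 : NonZero f
        f≢0 = >-nonZero (0<fib (suc k))

      -- Dividing a - 1 instead of a puts the remainder ρ of a into 1, ..., f, so that ρ - 1 can
      -- serve as the y of a representation.
      r ρ : ℕ
      r = (a ∸ 1) / f
      ρ = suc ((a ∸ 1) % f)

      a≡ : a ≡ ρ + r * f
      a≡ = trans (sym (m+[n∸m]≡n (0<lucas (3 + n)))) (cong suc (m≡m%n+[m/n]*n (a ∸ 1) f))

      a≡3fib+ : a ≡ 3 * fib (2 + n) + fib (1 + n)
      a≡3fib+ = trans (lucas-fib (2 + n)) (regroup (fib (2 + n)) (fib (1 + n)))
        where
        regroup : ∀ x y → x + y + 2 * x ≡ 3 * x + y
        regroup = solve-∀

    -- From Lᵢ = 3 Fᵢ₋₁ + Fᵢ₋₂ follows 3 Fᵢ₋₁ < Lᵢ ≤ 3 Fᵢ, so the quotient drops below 3 exactly at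
    -- k = i.
    lucas-quotient : 3 ≤ r ⇔ 2 + k ≤ 2 + n
    lucas-quotient = mk⇔ forward backward
      where
      open ≤-Reasoning
      forward : 3 ≤ r → 2 + k ≤ 2 + n
      forward 3≤r = ≮⇒≥ λ i≤k → <-irrefl refl (begin-strict
        3 * fib (2 + n) + fib (1 + n)     ≤⟨ +-monoʳ-≤ (3 * fib (2 + n)) (m≤m+n (fib (1 + n)) (2 * fib (1 + n))) ⟩
        3 * fib (2 + n) + 3 * fib (1 + n) ≡⟨ *-distribˡ-+ 3 (fib (2 + n)) (fib (1 + n)) ⟨
        3 * fib (3 + n)                   ≤⟨ *-monoʳ-≤ 3 (fib-mono i≤k) ⟩
        3 * f                             ≤⟨ *-monoˡ-≤ f 3≤r ⟩
        r * f                             <⟨ m<n+m (r * f) z<s ⟩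
        ρ + r * f                         ≡⟨ a≡ ⟨
        a                                 ≡⟨ a≡3fib+ ⟩
        3 * fib (2 + n) + fib (1 + n)     ∎)
      backward : 2 + k ≤ 2 + n → 3 ≤ r
      backward k<i = begin
        3             ≡⟨ m*n/n≡m 3 f ⟨
        3 * f / f     ≤⟨ /-monoˡ-≤ f (s≤s⁻¹ (begin
          suc (3 * f)                   ≤⟨ s≤s (*-monoʳ-≤ 3 (fib-mono k<i)) ⟩
          suc (3 * fib (2 + n))         ≡⟨ +-comm 1 _ ⟩
          3 * fib (2 + n) + 1           ≤⟨ +-monoʳ-≤ (3 * fib (2 + n)) (0<fib n) ⟩
          3 * fib (2 + n) + fib (1 + n) ≡⟨ a≡3fib+ ⟨
          a                             ≡⟨ m+[n∸m]≡n (0<lucas (3 + n)) ⟨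
          suc (a ∸ 1)                   ∎)) ⟩
        (a ∸ 1) / f   ∎

    lucas-remainder : ∃[ ρ ] (ρ ≤ f × a ≡ ρ + (a ∸ 1) / f * f)
    lucas-remainder = ρ , m%n<n (a ∸ 1) f , a≡

    module _ {r ρ : ℕ} (a≡ : a ≡ ρ + (3 + r) * f) (ρ≤f : ρ ≤ f) where
      private
        relation : c + e * a ≡ f * b
        relation = lucas-shift (3 + n) k

        a≡′ : a ≡ ρ + f * (3 + r)
        a≡′ = trans a≡ (cong (ρ +_) (*-comm (3 + r) f))

        2a≤b : 2 * a ≤ b
        2a≤b = 2lucas≤lucas (2 + n)

        e≤f : e ≤ f
        e≤f = fib-mono (m≤n+m k 2)

        f≤a : f ≤ a
        f≤a = ≤-trans (m≤m*n f (3 + r)) (≤-trans (m≤n+m _ ρ) (≤-reflexive (sym a≡′)))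

        bounded-by-c : ∀ {x} → x ≤ f * a → x ≤ c
        bounded-by-c {x} x≤fa = +-cancelʳ-≤ (e * a) x c (begin
          x + e * a       ≤⟨ +-mono-≤ x≤fa (*-monoˡ-≤ a e≤f) ⟩
          f * a + f * a   ≡⟨ trans (cong (λ k → f * (a + k)) (+-identityʳ a)) (*-distribˡ-+ f a a) ⟨
          f * (2 * a)     ≤⟨ *-monoʳ-≤ f 2a≤b ⟩
          f * b           ≡⟨ relation ⟨
          c + e * a       ∎)
          where open ≤-Reasoning

        certificate : ∀ {J Y Z} → 2 ≤ Z → Y ≤ f → 0 < J → J ≤ 3 * f → J + 1 * a ≡ Y + f * Z →
                      b * f + c * (5 + r) ≤ b * Y + c * Z → b * ρ + c * (6 + r) ≤ b * Y + c * Z →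
                      Certificate 3 a b c e f Y Z
        certificate = certificate-g relation a≡′ ρ≤f (fib-mono (s≤s (s≤s 1≤k))) (0<lucas (3 + n))
          (≤-trans (m≤m+n a (a + 0)) 2a≤b) (bounded-by-c (*-monoˡ-≤ a e≤f))
          (bounded-by-c (≤-trans (*-monoʳ-≤ e f≤a) (*-monoˡ-≤ a e≤f)))

      -- Since b f = c + e a, the two corners compare as e a with ρ b. J = 3 f closes the range of
      -- classes in which row 0 alone does not yet supply four pairs.
      lucas-certificate-g₁ : e * a ≤ ρ * b → Certificate 3 a b c e f ρ (6 + r)
      lucas-certificate-g₁ ea≤ρb = certificate (s≤s (s≤s z≤n)) ρ≤f (≤-trans (0<fib (suc k)) (m≤m+n f _)) ≤-refl
        (trans (cong (λ k → 3 * f + 1 * k) a≡′) (regroup f ρ r))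
        (begin
          b * f + c * (5 + r)            ≡⟨ cong (_+ c * (5 + r)) (trans (*-comm b f) (sym relation)) ⟩
          c + e * a + c * (5 + r)        ≤⟨ +-monoˡ-≤ (c * (5 + r)) (+-monoʳ-≤ c ea≤ρb) ⟩
          c + ρ * b + c * (5 + r)        ≡⟨ regroup′ b c ρ r ⟩
          b * ρ + c * (6 + r)            ∎) ≤-refl
        where
        open ≤-Reasoning
        regroup : ∀ f ρ r → 3 * f + 1 * (ρ + f * (3 + r)) ≡ ρ + f * (6 + r)
        regroup = solve-∀
        regroup′ : ∀ b c ρ r → c + ρ * b + c * (5 + r) ≡ b * ρ + c * (6 + r)
        regroup′ = solve-∀

      -- Here the corner without carry is the larger. J = 3 f - ρ closes the range of classes with
      -- z₀ = 2 and y₀ + ρ < f.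
      lucas-certificate-g₂ : ρ * b ≤ e * a → Certificate 3 a b c e f f (5 + r)
      lucas-certificate-g₂ ρb≤ea = certificate {J = 3 * f ∸ ρ} (s≤s (s≤s z≤n)) ≤-refl (m<n⇒0<n∸m ρ<3f) (m∸n≤m _ ρ)
        (begin-equality
          3 * f ∸ ρ + 1 * a                       ≡⟨ cong (λ k → 3 * f ∸ ρ + 1 * k) a≡′ ⟩
          3 * f ∸ ρ + 1 * (ρ + f * (3 + r))      ≡⟨ regroup (3 * f ∸ ρ) f ρ r ⟩
          3 * f ∸ ρ + ρ + f * (3 + r)            ≡⟨ cong (_+ f * (3 + r)) (m∸n+n≡m (<⇒≤ ρ<3f)) ⟩
          3 * f + f * (3 + r)                    ≡⟨ regroup′ f r ⟩
          f + f * (5 + r)                        ∎)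
        ≤-refl
        (begin
          b * ρ + c * (6 + r)            ≡⟨ regroup″ b c ρ r ⟨
          c + ρ * b + c * (5 + r)        ≤⟨ +-monoˡ-≤ (c * (5 + r)) (+-monoʳ-≤ c ρb≤ea) ⟩
          c + e * a + c * (5 + r)        ≡⟨ cong (_+ c * (5 + r)) (trans relation (*-comm f b)) ⟩
          b * f + c * (5 + r)            ∎)
        where
        open ≤-Reasoning
        ρ<3f : ρ < 3 * f
        ρ<3f = ≤-<-trans ρ≤f (m<m+n f (≤-trans (0<fib (suc k)) (m≤m+n f _)))
        regroup : ∀ j f ρ r → j + 1 * (ρ + f * (3 + r)) ≡ j + ρ + f * (3 + r)
        regroup = solve-∀
        regroup′ : ∀ f r → 3 * f + f * (3 + r) ≡ f + f * (5 + r)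
        regroup′ = solve-∀
        regroup″ : ∀ b c ρ r → c + ρ * b + c * (5 + r) ≡ b * ρ + c * (6 + r)
        regroup″ = solve-∀

-- Passage to integers and assembly of the cases.

open import Data.Integer.Base using (ℤ; +_; _+_; _-_; _*_; _≤_; _<_)
open import Data.Nat.Base as ℕ using (ℕ; _∸_; _/_)
open import Data.Product.Base using (_×_)
open import Function.Bundles using (_⇔_)
open import Relation.Binary.PropositionalEquality using (_≡_)

open import Data.Integer.Properties using (pos-*; *-identityˡ; +-identityʳ; drop‿+≤+; drop‿+<+)
open import Data.Integer.Tactic.RingSolver using (solve-∀)
import Data.Nat.Properties as ℕₚ
import Data.Nat.Tactic.RingSolver as ℕSolver
open import Data.Nat.Base using (suc; s≤s; z≤n; z<s)
open import Data.Product.Base using (_,_)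
open import Relation.Binary.PropositionalEquality using (refl; sym; trans; cong; cong₂; subst; subst₂; module ≡-Reasoning)
open FibonacciLucas
open FormCertificates
open Frobenius using (Certificate; frobenius)
open LinearForms using (module Evaluation)

-- `y` and `z` are arbitrary integer expressions for `Y` and `Z * L m`, so that each case keeps the
-- shape in which it is stated.
lucas-frobenius : ∀ i m {a b e f Y Z} → Certificate 3 a b (lucas m) e f Y Z → a ≡ lucas i → b ≡ lucas (i ℕ.+ 2) →
                  ∀ y z → y ≡ + Y → z ≡ + Z * L m →
                  IsFrobeniusNumber 3 (lucasTriple i m) ((y - + 1) * L (i ℕ.+ 2) + z - L i)
lucas-frobenius i m {Y = Y} {Z} cert refl refl y z refl refl =
  frobenius cert (Generators.positive (lucasTriple i m)) (Generators.coprime (lucasTriple i m)) (lucas-coprime i) (begin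
    (+ Y - + 1) * L (i ℕ.+ 2) + + Z * L m - L i + (L i + L (i ℕ.+ 2))
      ≡⟨ cancel (+ Y) (+ Z) (L i) (L (i ℕ.+ 2)) (L m) ⟩
    L (i ℕ.+ 2) * + Y + L m * + Z
      ≡⟨ cong₂ _+_ (pos-* (lucas (i ℕ.+ 2)) Y) (pos-* (lucas m) Z) ⟨
    + (lucas (i ℕ.+ 2) ℕ.* Y ℕ.+ lucas m ℕ.* Z) ∎)
  where
  open ≡-Reasoning
  cancel : ∀ y z a b c → (y - + 1) * b + z * c - a + (a + b) ≡ b * y + c * z
  cancel = solve-∀

lucas-frobenius₀ : ∀ i m {a b e f Y} → Certificate 3 a b (lucas m) e f Y 0 → a ≡ lucas i → b ≡ lucas (i ℕ.+ 2) →
                   ∀ y → y ≡ + Y → IsFrobeniusNumber 3 (lucasTriple i m) ((y - + 1) * L (i ℕ.+ 2) - L i)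
lucas-frobenius₀ i m cert a≡ b≡ y y≡ =
  subst (λ x → IsFrobeniusNumber 3 (lucasTriple i m) (x - L i)) (+-identityʳ ((y - + 1) * L (i ℕ.+ 2)))
    (lucas-frobenius i m cert a≡ b≡ y (+ 0) y≡ refl)

difference : ∀ {u v w} → u ≡ w ℕ.+ v → + u - + v ≡ + w
difference {v = v} {w} refl = cancel (+ w) (+ v)
  where
  cancel : ∀ w v → w + v - v ≡ w
  cancel = solve-∀

module _ (n : ℕ) where

  private
    lucas-index : ∀ h → ⟦_⟧ n (lucasForm (2 ℕ.+ h)) ≡ lucas (ℕ.suc h ℕ.+ n ℕ.+ 2)
    lucas-index h = trans (⟦lucas⟧ n (2 ℕ.+ h)) (cong lucas (ℕₚ.+-comm 2 (ℕ.suc h ℕ.+ n)))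

    n*fib : ∀ x m u → ⟦_⟧ n (x LinearForms.⊙ fibForm m) ≡ u → + x * F (m ℕ.+ n) ≡ + u
    n*fib x m u refl = trans (sym (pos-* x (fib (m ℕ.+ n))))
      (cong +_ (trans (cong (x ℕ.*_) (sym (⟦fib⟧ n m))) (sym (⟦⊙⟧ n x (fibForm m)))))

  frobenius-b : IsFrobeniusNumber 3 (lucasTriple (3 ℕ.+ n) (2 ℕ.* (3 ℕ.+ n) ℕ.+ 4))
    ((+ 4 * F (2 ℕ.+ n) - F (1 ℕ.+ n) - + 1) * L (3 ℕ.+ n ℕ.+ 2) + L (2 ℕ.* (3 ℕ.+ n) ℕ.+ 4) - L (3 ℕ.+ n))
  frobenius-b = lucas-frobenius (3 ℕ.+ n) (2 ℕ.* (3 ℕ.+ n) ℕ.+ 4)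
    (certificate-b _ _ (0<s+t n) (⟦shift⟧ n 2 5 (index n))) (⟦lucas⟧ n 2) (lucas-index 2)
    (+ 4 * F (2 ℕ.+ n) - F (1 ℕ.+ n)) (L (2 ℕ.* (3 ℕ.+ n) ℕ.+ 4))
    (trans (cong₂ _-_ (n*fib 4 2 _ refl) (cong +_ (sym (⟦fib⟧ n 1)))) (difference (⟦⊕⟧ n (7 , 3) (1 , 1))))
    (sym (*-identityˡ _))
    where
    index : ∀ n → 2 ℕ.* (3 ℕ.+ n) ℕ.+ 4 ≡ 2 ℕ.+ (5 ℕ.+ n) ℕ.+ (3 ℕ.+ n)
    index = ℕSolver.solve-∀

  frobenius-c : IsFrobeniusNumber 3 (lucasTriple (3 ℕ.+ n) (2 ℕ.* (3 ℕ.+ n) ℕ.+ 3))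
    ((+ 4 * F (3 ℕ.+ n ℕ.+ 1) - + 1) * L (3 ℕ.+ n ℕ.+ 2) - L (3 ℕ.+ n))
  frobenius-c = lucas-frobenius₀ (3 ℕ.+ n) (2 ℕ.* (3 ℕ.+ n) ℕ.+ 3)
    (certificate-c _ _ (0<s+t n) (⟦shift⟧ n 2 4 (index n))) (⟦lucas⟧ n 2) (lucas-index 2)
    (+ 4 * F (3 ℕ.+ n ℕ.+ 1))
    (trans (cong (λ k → + 4 * F k) (ℕₚ.+-comm (3 ℕ.+ n) 1)) (n*fib 4 4 _ refl))
    where
    index : ∀ n → 2 ℕ.* (3 ℕ.+ n) ℕ.+ 3 ≡ 2 ℕ.+ (4 ℕ.+ n) ℕ.+ (3 ℕ.+ n)
    index = ℕSolver.solve-∀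

  frobenius-d : IsFrobeniusNumber 3 (lucasTriple (3 ℕ.+ n) (2 ℕ.* (3 ℕ.+ n) ℕ.+ 2))
    ((F (3 ℕ.+ n) + + 2 * F n - + 1) * L (3 ℕ.+ n ℕ.+ 2) + + 2 * L (2 ℕ.* (3 ℕ.+ n) ℕ.+ 2) - L (3 ℕ.+ n))
  frobenius-d = lucas-frobenius (3 ℕ.+ n) (2 ℕ.* (3 ℕ.+ n) ℕ.+ 2)
    (certificate-d _ _ (0<s+t n) (⟦shift⟧ n 2 3 (index n))) (⟦lucas⟧ n 2) (lucas-index 2)
    (F (3 ℕ.+ n) + + 2 * F n) _
    (trans (cong₂ _+_ (cong +_ (sym (⟦fib⟧ n 3))) (n*fib 2 0 _ refl)) (cong +_ (sym (⟦⊕⟧ n (3 , 2) (2 , 0))))) refl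
    where
    index : ∀ n → 2 ℕ.* (3 ℕ.+ n) ℕ.+ 2 ≡ 2 ℕ.+ (3 ℕ.+ n) ℕ.+ (3 ℕ.+ n)
    index = ℕSolver.solve-∀

  frobenius-e : IsFrobeniusNumber 3 (lucasTriple (3 ℕ.+ n) (2 ℕ.* (3 ℕ.+ n) ℕ.+ 1))
    ((F (2 ℕ.+ n) - + 1) * L (3 ℕ.+ n ℕ.+ 2) + + 3 * L (2 ℕ.* (3 ℕ.+ n) ℕ.+ 1) - L (3 ℕ.+ n))
  frobenius-e = lucas-frobenius (3 ℕ.+ n) (2 ℕ.* (3 ℕ.+ n) ℕ.+ 1)
    (certificate-e _ _ (0<s+t n) (⟦shift⟧ n 2 2 (index n))) (⟦lucas⟧ n 2) (lucas-index 2)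
    (F (2 ℕ.+ n)) _ (cong +_ (sym (⟦fib⟧ n 2))) refl
    where
    index : ∀ n → 2 ℕ.* (3 ℕ.+ n) ℕ.+ 1 ≡ 2 ℕ.+ (2 ℕ.+ n) ℕ.+ (3 ℕ.+ n)
    index = ℕSolver.solve-∀

  frobenius-f : IsFrobeniusNumber 3 (lucasTriple (4 ℕ.+ n) (2 ℕ.* (4 ℕ.+ n)))
    ((+ 2 * F (1 ℕ.+ n) - + 1) * L (4 ℕ.+ n ℕ.+ 2) + + 4 * L (2 ℕ.* (4 ℕ.+ n)) - L (4 ℕ.+ n))
  frobenius-f = lucas-frobenius (4 ℕ.+ n) (2 ℕ.* (4 ℕ.+ n))
    (certificate-f _ _ (0<s+t n) (⟦shift⟧ n 3 2 (index n))) (⟦lucas⟧ n 3) (lucas-index 3)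
    (+ 2 * F (1 ℕ.+ n)) _ (n*fib 2 1 _ refl) refl
    where
    index : ∀ n → 2 ℕ.* (4 ℕ.+ n) ≡ 2 ℕ.+ (2 ℕ.+ n) ℕ.+ (4 ℕ.+ n)
    index = ℕSolver.solve-∀

  frobenius-a : ∀ k → 3 ℕ.+ n ℕ.+ 5 ℕ.≤ 3 ℕ.+ k → IsFrobeniusNumber 3 (lucasTriple (3 ℕ.+ n) (3 ℕ.+ n ℕ.+ (3 ℕ.+ k)))
    ((+ 4 * L (3 ℕ.+ n) - + 1) * L (3 ℕ.+ n ℕ.+ 2) - L (3 ℕ.+ n))
  frobenius-a k i+5≤k = subst
    (λ m → IsFrobeniusNumber 3 (lucasTriple (3 ℕ.+ n) m) ((+ 4 * L (3 ℕ.+ n) - + 1) * L (3 ℕ.+ n ℕ.+ 2) - L (3 ℕ.+ n)))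
    (ℕₚ.+-comm (3 ℕ.+ k) (3 ℕ.+ n))
    (lucas-frobenius₀ (3 ℕ.+ n) (3 ℕ.+ k ℕ.+ (3 ℕ.+ n)) (lucas-certificate-a n i+5≤k) refl
      (cong lucas (ℕₚ.+-comm 2 (3 ℕ.+ n))) (+ 4 * L (3 ℕ.+ n)) (sym (pos-* 4 (lucas (3 ℕ.+ n)))))

  module _ (k : ℕ) {ρ : ℕ} where

    frobenius-g : ∀ r → lucas (3 ℕ.+ n) ≡ ρ ℕ.+ r ℕ.* fib (3 ℕ.+ k) → ρ ℕ.≤ fib (3 ℕ.+ k) → 3 ℕ.≤ r →
      (F (1 ℕ.+ k) * L (3 ℕ.+ n) ≤ (L (3 ℕ.+ n) - + r * F (3 ℕ.+ k)) * L (3 ℕ.+ n ℕ.+ 2) →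
        IsFrobeniusNumber 3 (lucasTriple (3 ℕ.+ n) (3 ℕ.+ n ℕ.+ (3 ℕ.+ k)))
          ((L (3 ℕ.+ n) - + r * F (3 ℕ.+ k) - + 1) * L (3 ℕ.+ n ℕ.+ 2) +
           (+ r + + 3) * L (3 ℕ.+ n ℕ.+ (3 ℕ.+ k)) - L (3 ℕ.+ n)))
      ×
      ((L (3 ℕ.+ n) - + r * F (3 ℕ.+ k)) * L (3 ℕ.+ n ℕ.+ 2) < F (1 ℕ.+ k) * L (3 ℕ.+ n) →
        IsFrobeniusNumber 3 (lucasTriple (3 ℕ.+ n) (3 ℕ.+ n ℕ.+ (3 ℕ.+ k)))
          ((F (3 ℕ.+ k) - + 1) * L (3 ℕ.+ n ℕ.+ 2) + (+ r + + 2) * L (3 ℕ.+ n ℕ.+ (3 ℕ.+ k)) - L (3 ℕ.+ n)))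
    frobenius-g r@(suc (suc (suc r′))) a≡ ρ≤f (s≤s (s≤s (s≤s z≤n))) =
        (λ ea≤ρb → lucas-frobenius (3 ℕ.+ n) m
          (reindex (lucas-certificate-g₁ n (suc k) z<s {r′} a≡ ρ≤f
            (drop‿+≤+ (subst₂ _≤_ ea≡ ρb≡ ea≤ρb))))
          refl b≡ (L (3 ℕ.+ n) - + r * F (3 ℕ.+ k)) _ ρ≡ (cong (λ j → + j * L m) (ℕₚ.+-comm r 3)))
      , (λ ρb<ea → lucas-frobenius (3 ℕ.+ n) m
          (reindex (lucas-certificate-g₂ n (suc k) z<s {r′} a≡ ρ≤f
            (ℕₚ.<⇒≤ (drop‿+<+ (subst₂ _<_ ρb≡ ea≡ ρb<ea)))))
          refl b≡ (F (3 ℕ.+ k)) _ refl (cong (λ j → + j * L m) (ℕₚ.+-comm r 2)))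
      where
      m = 3 ℕ.+ n ℕ.+ (3 ℕ.+ k)
      b≡ : lucas (5 ℕ.+ n) ≡ lucas (3 ℕ.+ n ℕ.+ 2)
      b≡ = cong lucas (ℕₚ.+-comm 2 (3 ℕ.+ n))
      reindex : ∀ {a b e f Y Z} → Certificate 3 a b (lucas (3 ℕ.+ k ℕ.+ (3 ℕ.+ n))) e f Y Z →
                Certificate 3 a b (lucas m) e f Y Z
      reindex {a} {b} {e} {f} {Y} {Z} = subst (λ j → Certificate 3 a b (lucas j) e f Y Z) (ℕₚ.+-comm (3 ℕ.+ k) (3 ℕ.+ n))
      ρ≡ : L (3 ℕ.+ n) - + r * F (3 ℕ.+ k) ≡ + ρ
      ρ≡ = trans (cong (λ x → L (3 ℕ.+ n) - x) (sym (pos-* r (fib (3 ℕ.+ k))))) (difference a≡)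
      ea≡ : F (1 ℕ.+ k) * L (3 ℕ.+ n) ≡ + (fib (1 ℕ.+ k) ℕ.* lucas (3 ℕ.+ n))
      ea≡ = sym (pos-* (fib (1 ℕ.+ k)) (lucas (3 ℕ.+ n)))
      ρb≡ : (L (3 ℕ.+ n) - + r * F (3 ℕ.+ k)) * L (3 ℕ.+ n ℕ.+ 2) ≡ + (ρ ℕ.* lucas (5 ℕ.+ n))
      ρb≡ = trans (cong₂ (λ x b → x * + b) ρ≡ (sym b≡)) (sym (pos-* ρ (lucas (5 ℕ.+ n))))

-- The value is 33 + 36 - 4 = 65; the number 69 in the English statement is the sum before `L 3` is
-- subtracted.
frobenius-f₃ : IsFrobeniusNumber 3 (lucasTriple 3 6) (+ 3 * L 5 + + 2 * L 6 - L 3)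
frobenius-f₃ = lucas-frobenius 3 6 (certificate-f₃ 1 0 z<s relation) (const 4) (const 11) (+ 4) (+ 36) (cong +_ (sym (const 4))) refl
  where
  module Constant = Evaluation 1 0
  const : ∀ x → Constant.⟦ x , x ⟧ ≡ x
  const x = trans (Constant.⟦n,n⟧ x) (ℕₚ.*-identityʳ x)
  relation : 18 ℕ.+ Constant.⟦ 1 , 1 ⟧ ℕ.* Constant.⟦ 4 , 4 ⟧ ≡ Constant.⟦ 2 , 2 ⟧ ℕ.* Constant.⟦ 11 , 11 ⟧
  relation = trans (cong₂ (λ x y → 18 ℕ.+ x ℕ.* y) (const 1) (const 4)) (sym (cong₂ ℕ._*_ (const 2) (const 11)))

theorem8 :
  (i k : ℕ) → 3 ℕ.≤ i → (3≤k : 3 ℕ.≤ k) →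
  -- (a)
  (i ℕ.+ 5 ℕ.≤ k →
    IsFrobeniusNumber 3 (lucasTriple i (i ℕ.+ k))
      ((+ 4 * L i - + 1) * L (i ℕ.+ 2) - L i))
  ×
  -- (b)
  IsFrobeniusNumber 3 (lucasTriple i (2 ℕ.* i ℕ.+ 4))
    ((+ 4 * F (i ∸ 1) - F (i ∸ 2) - + 1) * L (i ℕ.+ 2) + L (2 ℕ.* i ℕ.+ 4) - L i)
  ×
  -- (c)
  IsFrobeniusNumber 3 (lucasTriple i (2 ℕ.* i ℕ.+ 3))
    ((+ 4 * F (i ℕ.+ 1) - + 1) * L (i ℕ.+ 2) - L i)
  ×
  -- (d)
  IsFrobeniusNumber 3 (lucasTriple i (2 ℕ.* i ℕ.+ 2))
    ((F i + + 2 * F (i ∸ 3) - + 1) * L (i ℕ.+ 2) + + 2 * L (2 ℕ.* i ℕ.+ 2) - L i)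
  ×
  -- (e)
  IsFrobeniusNumber 3 (lucasTriple i (2 ℕ.* i ℕ.+ 1))
    ((F (i ∸ 1) - + 1) * L (i ℕ.+ 2) + + 3 * L (2 ℕ.* i ℕ.+ 1) - L i)
  ×
  -- (f)
  (4 ℕ.≤ i →
    IsFrobeniusNumber 3 (lucasTriple i (2 ℕ.* i))
      ((+ 2 * F (i ∸ 3) - + 1) * L (i ℕ.+ 2) + + 4 * L (2 ℕ.* i) - L i))
  ×
  IsFrobeniusNumber 3 (lucasTriple 3 6) (+ 3 * L 5 + + 2 * L 6 - L 3)
  ×
  + 3 * L 5 + + 2 * L 6 - L 3 ≡ + 65
  ×
  -- (g)
  (let r : ℕ
       r = _/_ (lucas i ∸ 1) (fib k) {{fib-nonZero 3≤k}}
   in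
   (3 ℕ.≤ r ⇔ k ℕ.≤ i ∸ 1)
   ×
   (3 ℕ.≤ r →
     (F (k ∸ 2) * L i ≤ (L i - + r * F k) * L (i ℕ.+ 2) →
       IsFrobeniusNumber 3 (lucasTriple i (i ℕ.+ k))
         ((L i - + r * F k - + 1) * L (i ℕ.+ 2) + (+ r + + 3) * L (i ℕ.+ k) - L i))
     ×
     ((L i - + r * F k) * L (i ℕ.+ 2) < F (k ∸ 2) * L i →
       IsFrobeniusNumber 3 (lucasTriple i (i ℕ.+ k))
         ((F k - + 1) * L (i ℕ.+ 2) + (+ r + + 2) * L (i ℕ.+ k) - L i))))
theorem8 _ _ (s≤s (s≤s (s≤s (z≤n {n})))) 3≤k@(s≤s (s≤s (s≤s (z≤n {k})))) =
    frobenius-a n k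
  , frobenius-b n
  , frobenius-c n
  , frobenius-d n
  , frobenius-e n
  , (λ { (s≤s (s≤s (s≤s (s≤s (z≤n {n}))))) → frobenius-f n })
  , frobenius-f₃
  , refl
  , lucas-quotient n (suc k) z<s
  , (λ 3≤r → let ρ , ρ≤f , a≡ = lucas-remainder n (suc k) z<s in frobenius-g n k _ a≡ ρ≤f 3≤r)
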